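{- Let $G$ be a finite simple graph on $n$ vertices with at least one edge, and let $\omega=\omega(G)$ be its clique number. Then there exists a probability distribution $\mathcal D_{\mathcal P}$ over partitions of $V(G)$ into at most $\omega$ parts such that, for every choice of nonnegative real edge weights $a=(a_e)_{e\in E(G)}$, $$\mathbb{E}_{\mathcal P\sim\mathcal D_{\mathcal P}}\,W_{\mathcal P}(a)\;\ge\;\frac{2}{\left(1-\frac1\omega\right)n^2}\Bigl(\sum_{e\in E(G)}\sqrt{a_e}\Bigr)^{2}.$$ (The distribution depends only on $G$, not on the weights $a$.)
   Context: Graphs are finite and simple. The clique number $\omega(G)$ is the largest number of vertices in a clique of $G$. For a partition $\mathcal P$ of $V(G)$ and nonnegative edge weights $a=(a_e)_{e\in E(G)}$, the separated mass is $$W_{\mathcal P}(a):=\sum_{\substack{uv\in E(G)\\ u,\,v\text{ in different parts of }\mathcal P}} a_{uv},$$ where each (undirected) edge is counted once. -}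

module Defs where

open import Data.Empty using (⊥)
open import Data.Fin.Base as Fin using (Fin)
import Data.Fin.Properties as Fin
open import Data.Fin.Subset using (Subset; ∣_∣; _∈_; _∩_; _∪_; ⁅_⁆; Nonempty; Empty)
open import Data.Fin.Subset.Properties using (x∈⁅x⁆; x∈⁅y⁆⇒x≡y; x∈p∪q⁻; p⊆p∪q; q⊆p∪q; ∣⁅x⁆∣≡1; p⊂q⇒∣p∣<∣q∣)
open import Data.Integer.Base as ℤ using (+_)
import Data.Integer.Properties as ℤ
open import Data.List.Base using (List; length)
open import Data.List.Relation.Unary.All using (All)
open import Data.List.Relation.Unary.AllPairs using (AllPairs)
open import Data.List.Relation.Unary.Any using (Any; index)
open import Data.Nat.Base as ℕ using (ℕ; zero; suc)
import Data.Nat.Properties as ℕ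
open import Data.Product.Base using (Σ; ∃; ∃-syntax; _×_; _,_; proj₁; proj₂)
open import Data.Rational.Base as ℚ using (ℚ; 0ℚ; 1ℚ; ½; _+_; _*_; _-_; -_; _÷_; 1/_; _/_; _≤_; _<_; toℚᵘ; ↥_; ↧ₙ_)
import Data.Rational.Properties as ℚ
open import Data.Rational.Solver using (module +-*-Solver)
import Data.Rational.Unnormalised.Base as ℚᵘ
import Data.Rational.Unnormalised.Properties as ℚᵘ
open import Data.Sum.Base using (_⊎_; inj₁; inj₂; map₁)
open import Data.Vec.Functional using (foldr)
open import Relation.Binary.Core using (Rel)
open import Relation.Binary.Definitions using (Decidable; Symmetric; Irreflexive)
open import Relation.Binary.PropositionalEquality using (_≡_; _≢_; refl; sym; trans; cong; cong₂; subst)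
open import Relation.Nullary.Decidable using (Dec; yes; no; recompute; _×-dec_)
open import Relation.Nullary.Negation using (contradiction)
open import Level using (0ℓ)

private
  open +-*-Solver using (solve; _:=_; _:+_; _:*_; _:-_; :-_; con)

  ≤-by : ∀ {p q} d → 0ℚ ≤ d → q ≡ p + d → p ≤ q
  ≤-by {p} {q} d 0≤d eq = begin
    p       ≡⟨ ℚ.+-identityʳ p ⟨
    p + 0ℚ  ≤⟨ ℚ.+-monoʳ-≤ p 0≤d ⟩
    p + d   ≡⟨ eq ⟨
    q       ∎
    where open ℚ.≤-Reasoning

  0≤+ : ∀ {p q} → 0ℚ ≤ p → 0ℚ ≤ q → 0ℚ ≤ p + q
  0≤+ = ℚ.+-mono-≤

  *-mono : ∀ {p q r s} → 0ℚ ≤ p → 0ℚ ≤ s → p ≤ q → r ≤ s → p * r ≤ q * s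
  *-mono {p} {q} {r} {s} 0≤p 0≤s p≤q r≤s = ℚ.≤-trans
    (ℚ.*-monoˡ-≤-nonNeg p {{ℚ.nonNegative 0≤p}} r≤s)
    (ℚ.*-monoʳ-≤-nonNeg s {{ℚ.nonNegative 0≤s}} p≤q)

  0≤* : ∀ {p q} → 0ℚ ≤ p → 0ℚ ≤ q → 0ℚ ≤ p * q
  0≤* 0≤p 0≤q = *-mono ℚ.≤-refl 0≤q 0≤p 0≤q

  0<* : ∀ {p q} → 0ℚ < p → 0ℚ < q → 0ℚ < p * q
  0<* {p} {q} 0<p 0<q = ℚ.positive⁻¹ (p * q)
    {{ℚ.pos*pos⇒pos p {{ℚ.positive 0<p}} q {{ℚ.positive 0<q}}}}

  0<½ : 0ℚ < ½
  0<½ = ℚ.positive⁻¹ ½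

  half+half : ∀ ε → ½ * ε + ½ * ε ≡ ε
  half+half = solve 1 (λ e → con ½ :* e :+ con ½ :* e := e) refl

  inverse : ∀ {p} → 0ℚ < p → ∃[ r ] 0ℚ < r × p * r ≡ 1ℚ
  inverse {p} 0<p = 1/ p , ℚ.positive⁻¹ _ {{ℚ.1/pos⇒pos p}} , ℚ.*-inverseʳ p
    where
    instance
      _ = ℚ.positive 0<p
      _ = ℚ.pos⇒nonZero p

  p≤∣p∣ : ∀ p → p ≤ ℚ.∣ p ∣
  p≤∣p∣ p with ℚ.≤-total 0ℚ p
  ... | inj₁ 0≤p = ℚ.≤-reflexive (sym (ℚ.0≤p⇒∣p∣≡p 0≤p))
  ... | inj₂ p≤0 = ℚ.≤-trans p≤0 (ℚ.0≤∣p∣ p)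

  ∣p-q∣≤r⇒p≤q+r : ∀ p q {r} → ℚ.∣ p - q ∣ ≤ r → p ≤ q + r
  ∣p-q∣≤r⇒p≤q+r p q {r} h = begin
    p            ≡⟨ solve 2 (λ p q → p := q :+ (p :- q)) refl p q ⟩
    q + (p - q)  ≤⟨ ℚ.+-monoʳ-≤ q (ℚ.≤-trans (p≤∣p∣ (p - q)) h) ⟩
    q + r        ∎
    where open ℚ.≤-Reasoning

  ∣p-q∣≤r : ∀ p q {r} → p ≤ q + r → q ≤ p + r → ℚ.∣ p - q ∣ ≤ r
  ∣p-q∣≤r p q {r} h k with ℚ.∣p∣≡p∨∣p∣≡-p (p - q)
  ... | inj₁ eq = begin
    ℚ.∣ p - q ∣  ≡⟨ eq ⟩
    p - q        ≤⟨ ℚ.+-monoˡ-≤ (- q) h ⟩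
    q + r - q    ≡⟨ solve 2 (λ q r → q :+ r :- q := r) refl q r ⟩
    r            ∎
    where open ℚ.≤-Reasoning
  ... | inj₂ eq = begin
    ℚ.∣ p - q ∣  ≡⟨ eq ⟩
    - (p - q)    ≡⟨ solve 2 (λ p q → :- (p :- q) := q :- p) refl p q ⟩
    q - p        ≤⟨ ℚ.+-monoˡ-≤ (- p) k ⟩
    p + r - p    ≡⟨ solve 2 (λ q r → q :+ r :- q := r) refl p r ⟩
    r            ∎
    where open ℚ.≤-Reasoning

fromℕ : ℕ → ℚ
fromℕ n = + n / 1

1/suc : ℕ → ℚ
1/suc n = + 1 / suc n

private
  0<1/suc : ∀ n → 0ℚ < 1/suc n
  0<1/suc n = ℚ.positive⁻¹ (1/suc n) {{ℚ.normalize-pos 1 (suc n)}}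

  /-mono-≤ : ∀ i j m n .{{_ : ℕ.NonZero m}} .{{_ : ℕ.NonZero n}} →
             i ℤ.* + n ℤ.≤ j ℤ.* + m → i / m ≤ j / n
  /-mono-≤ i j (suc m) (suc n) h = ℚ.toℚᵘ-cancel-≤ (begin
    toℚᵘ (i / suc m)  ≃⟨ ℚ.toℚᵘ-fromℚᵘ (ℚᵘ.mkℚᵘ i m) ⟩
    ℚᵘ.mkℚᵘ i m       ≤⟨ ℚᵘ.*≤* h ⟩
    ℚᵘ.mkℚᵘ j n       ≃⟨ ℚ.toℚᵘ-fromℚᵘ (ℚᵘ.mkℚᵘ j n) ⟨
    toℚᵘ (j / suc n)  ∎)
    where open ℚᵘ.≤-Reasoning

  archimedean : ∀ ε → 0ℚ < ε → ∀ n → ↧ₙ ε ℕ.≤ n → 1/suc n ≤ ε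
  archimedean ε 0<ε n h = subst (1/suc n ≤_) (ℚ.↥p/↧p≡p ε)
    (/-mono-≤ (+ 1) (↥ ε) (suc n) (↧ₙ ε) (begin
      + 1 ℤ.* + (↧ₙ ε)  ≤⟨ ℤ.*-monoˡ-≤-nonNeg (+ 1) (ℤ.+≤+ (ℕ.m≤n⇒m≤1+n h)) ⟩
      + 1 ℤ.* + suc n   ≤⟨ ℤ.*-monoʳ-≤-nonNeg (+ suc n) (1≤↥ ε (ℚ.positive 0<ε)) ⟩
      ↥ ε ℤ.* + suc n   ∎))
    where
    open ℤ.≤-Reasoning
    1≤↥ : ∀ p → ℚ.Positive p → + 1 ℤ.≤ ↥ p
    1≤↥ (ℚ.mkℚ (+ suc k) _ _) _ = ℤ.+≤+ (ℕ.s≤s ℕ.z≤n)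

  fromℕ-suc : ∀ n → fromℕ (suc n) ≡ fromℕ n + 1ℚ
  fromℕ-suc n = ℚ.toℚᵘ-injective (begin
    toℚᵘ (fromℕ (suc n))           ≈⟨ ℚ.toℚᵘ-fromℚᵘ (ℚᵘ.mkℚᵘ (+ suc n) 0) ⟩
    ℚᵘ.mkℚᵘ (+ suc n) 0            ≈⟨ ℚᵘ.*≡* (cong (ℤ._* + 1) eq) ⟩
    ℚᵘ.mkℚᵘ (+ n) 0 ℚᵘ.+ ℚᵘ.1ℚᵘ    ≈⟨ ℚᵘ.+-congˡ ℚᵘ.1ℚᵘ (ℚ.toℚᵘ-fromℚᵘ (ℚᵘ.mkℚᵘ (+ n) 0)) ⟨
    toℚᵘ (fromℕ n) ℚᵘ.+ ℚᵘ.1ℚᵘ     ≈⟨ ℚ.toℚᵘ-homo-+ (fromℕ n) 1ℚ ⟨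
    toℚᵘ (fromℕ n + 1ℚ)            ∎)
    where
    open ℚᵘ.≃-Reasoning
    eq : + suc n ≡ + n ℤ.* + 1 ℤ.+ + 1 ℤ.* + 1
    eq = trans (cong +_ (ℕ.+-comm 1 n)) (cong (ℤ._+ + 1) (sym (ℤ.*-identityʳ (+ n))))

  0≤fromℕ : ∀ n → 0ℚ ≤ fromℕ n
  0≤fromℕ n = ℚ.nonNegative⁻¹ (fromℕ n) {{ℚ.normalize-nonNeg n 1}}

  fromℕ-*-1/suc : ∀ k n → fromℕ (k ℕ.* suc n) * 1/suc n ≡ fromℕ k
  fromℕ-*-1/suc k n = ℚ.toℚᵘ-injective (begin
    toℚᵘ (fromℕ (k ℕ.* suc n) * 1/suc n)
      ≈⟨ ℚ.toℚᵘ-homo-* (fromℕ (k ℕ.* suc n)) (1/suc n) ⟩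
    toℚᵘ (fromℕ (k ℕ.* suc n)) ℚᵘ.* toℚᵘ (1/suc n)
      ≈⟨ ℚᵘ.*-cong (ℚ.toℚᵘ-fromℚᵘ (ℚᵘ.mkℚᵘ (+ (k ℕ.* suc n)) 0)) (ℚ.toℚᵘ-fromℚᵘ (ℚᵘ.mkℚᵘ (+ 1) n)) ⟩
    ℚᵘ.mkℚᵘ (+ (k ℕ.* suc n)) 0 ℚᵘ.* ℚᵘ.mkℚᵘ (+ 1) n
      ≈⟨ ℚᵘ.*≡* eq ⟩
    ℚᵘ.mkℚᵘ (+ k) 0
      ≈⟨ ℚ.toℚᵘ-fromℚᵘ (ℚᵘ.mkℚᵘ (+ k) 0) ⟨
    toℚᵘ (fromℕ k) ∎)
    where
    open ℚᵘ.≃-Reasoning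
    eq : + (k ℕ.* suc n) ℤ.* + 1 ℤ.* + 1 ≡ + k ℤ.* + (1 ℕ.* suc n)
    eq = trans (ℤ.*-identityʳ _) (trans (ℤ.*-identityʳ _)
      (trans (ℤ.pos-* k (suc n)) (cong (λ x → + k ℤ.* + x) (sym (ℕ.*-identityˡ (suc n))))))

  p≤fromℕ∣↥p∣ : ∀ p → p ≤ fromℕ ℤ.∣ ↥ p ∣
  p≤fromℕ∣↥p∣ p = subst (_≤ fromℕ ℤ.∣ ↥ p ∣) (ℚ.↥p/↧p≡p p)
    (/-mono-≤ (↥ p) (+ ℤ.∣ ↥ p ∣) (↧ₙ p) 1 (begin
      ↥ p ℤ.* + 1                  ≡⟨ ℤ.*-identityʳ (↥ p) ⟩
      ↥ p                          ≤⟨ i≤∣i∣ (↥ p) ⟩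
      + ℤ.∣ ↥ p ∣                  ≡⟨ ℤ.*-identityʳ (+ ℤ.∣ ↥ p ∣) ⟨
      + ℤ.∣ ↥ p ∣ ℤ.* + 1          ≤⟨ ℤ.*-monoˡ-≤-nonNeg (+ ℤ.∣ ↥ p ∣) (ℤ.+≤+ (ℕ.s≤s ℕ.z≤n)) ⟩
      + ℤ.∣ ↥ p ∣ ℤ.* + (↧ₙ p)     ∎))
    where
    open ℤ.≤-Reasoning
    i≤∣i∣ : ∀ i → i ℤ.≤ + ℤ.∣ i ∣
    i≤∣i∣ (+ n)        = ℤ.≤-refl
    i≤∣i∣ ℤ.-[1+ n ]   = ℤ.-≤+

-- Real numbers are Cauchy sequences of rationals with a modulus of
-- convergence, up to _≈ℝ_.

IsCauchy : (ℕ → ℚ) → Set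
IsCauchy s = ∀ ε → 0ℚ < ε → ∃[ N ] ∀ m n → N ℕ.≤ m → N ℕ.≤ n → ℚ.∣ s m - s n ∣ ≤ ε

record ℝ : Set where
  constructor mkℝ
  field
    seq    : ℕ → ℚ
    cauchy : IsCauchy seq

open ℝ public

infix  4 _≤ℝ_ _≈ℝ_
infixl 6 _+ℝ_
infixl 7 _*ℝ_

record _≤ℝ_ (x y : ℝ) : Set where
  constructor mk≤ℝ
  field
    bound : ∀ ε → 0ℚ < ε → ∃[ N ] ∀ n → N ℕ.≤ n → seq x n ≤ seq y n + ε

_≈ℝ_ : ℝ → ℝ → Set
x ≈ℝ y = x ≤ℝ y × y ≤ℝ x

fromℚ : ℚ → ℝ
fromℚ q = mkℝ (λ _ → q) λ ε 0<ε → 0 , λ _ _ _ _ →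
  ℚ.≤-trans (ℚ.≤-reflexive (cong ℚ.∣_∣ (ℚ.+-inverseʳ q))) (ℚ.<⇒≤ 0<ε)

0ℝ : ℝ
0ℝ = fromℚ 0ℚ

1ℝ : ℝ
1ℝ = fromℚ 1ℚ

private
  ⊔-left : ∀ {a b n} → a ℕ.⊔ b ℕ.≤ n → a ℕ.≤ n
  ⊔-left {a} {b} = ℕ.≤-trans (ℕ.m≤m⊔n a b)

  ⊔-right : ∀ {a b n} → a ℕ.⊔ b ℕ.≤ n → b ℕ.≤ n
  ⊔-right {a} {b} = ℕ.≤-trans (ℕ.m≤n⊔m a b)

-- The proofs of convergence are abstract because normalising the moduli is
-- prohibitively slow.
abstract
  +-cauchy : ∀ {s t} → IsCauchy s → IsCauchy t → IsCauchy (λ n → s n + t n)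
  +-cauchy {s} {t} c d ε 0<ε =
    let 0<h     = 0<* 0<½ 0<ε
        N₁ , h₁ = c (½ * ε) 0<h
        N₂ , h₂ = d (½ * ε) 0<h
    in N₁ ℕ.⊔ N₂ , λ m n N≤m N≤n → begin
      ℚ.∣ (s m + t m) - (s n + t n) ∣
        ≡⟨ cong ℚ.∣_∣ (solve 4 (λ a b c d → (a :+ b) :- (c :+ d) := (a :- c) :+ (b :- d)) refl
             (s m) (t m) (s n) (t n)) ⟩
      ℚ.∣ (s m - s n) + (t m - t n) ∣
        ≤⟨ ℚ.∣p+q∣≤∣p∣+∣q∣ (s m - s n) (t m - t n) ⟩
      ℚ.∣ s m - s n ∣ + ℚ.∣ t m - t n ∣
        ≤⟨ ℚ.+-mono-≤ (h₁ m n (⊔-left N≤m) (⊔-left N≤n))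
                      (h₂ m n (⊔-right {N₁} N≤m) (⊔-right {N₁} N≤n)) ⟩
      ½ * ε + ½ * ε
        ≡⟨ half+half ε ⟩
      ε ∎
    where open ℚ.≤-Reasoning

_+ℝ_ : ℝ → ℝ → ℝ
x +ℝ y = mkℝ (λ n → seq x n + seq y n) (+-cauchy {seq x} {seq y} (cauchy x) (cauchy y))

private
  tailBound : ∀ {s} → IsCauchy s → ∃[ B ] 0ℚ < B × ∃[ N ] ∀ n → N ℕ.≤ n → ℚ.∣ s n ∣ ≤ B
  tailBound {s} c =
    let N , h = c 1ℚ (ℚ.positive⁻¹ 1ℚ)
    in ℚ.∣ s N ∣ + 1ℚ
     , ℚ.+-mono-≤-< (ℚ.0≤∣p∣ (s N)) (ℚ.positive⁻¹ 1ℚ)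
     , N , λ n N≤n → begin
         ℚ.∣ s n ∣
           ≡⟨ cong ℚ.∣_∣ (solve 2 (λ a b → a := b :+ (a :- b)) refl (s n) (s N)) ⟩
         ℚ.∣ s N + (s n - s N) ∣
           ≤⟨ ℚ.∣p+q∣≤∣p∣+∣q∣ (s N) (s n - s N) ⟩
         ℚ.∣ s N ∣ + ℚ.∣ s n - s N ∣
           ≤⟨ ℚ.+-monoʳ-≤ ℚ.∣ s N ∣ (h n N N≤n ℕ.≤-refl) ⟩
         ℚ.∣ s N ∣ + 1ℚ ∎
    where open ℚ.≤-Reasoning

abstract
  *-cauchy : ∀ {s t} → IsCauchy s → IsCauchy t → IsCauchy (λ n → s n * t n)
  *-cauchy {s} {t} c d ε 0<ε =
    let A , 0<A , M₁ , a    = tailBound {s} c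
        B , 0<B , M₂ , b    = tailBound {t} d
        0<C                 = ℚ.+-mono-< 0<A 0<B
        r , 0<r , Cr≡1      = inverse 0<C
        0<η                 = 0<* 0<ε 0<r
        N₁ , h₁             = c (ε * r) 0<η
        N₂ , h₂             = d (ε * r) 0<η
    in (M₁ ℕ.⊔ M₂) ℕ.⊔ (N₁ ℕ.⊔ N₂) , λ m n N≤m N≤n →
      let xm = s m ; xn = s n ; ym = t m ; yn = t n
      in begin
      ℚ.∣ xm * ym - xn * yn ∣
        ≡⟨ cong ℚ.∣_∣ (solve 4 (λ a b c d → a :* b :- c :* d := a :* (b :- d) :+ d :* (a :- c)) refl
             xm ym xn yn) ⟩
      ℚ.∣ xm * (ym - yn) + yn * (xm - xn) ∣
        ≤⟨ ℚ.∣p+q∣≤∣p∣+∣q∣ (xm * (ym - yn)) (yn * (xm - xn)) ⟩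
      ℚ.∣ xm * (ym - yn) ∣ + ℚ.∣ yn * (xm - xn) ∣
        ≡⟨ cong₂ _+_ (ℚ.∣p*q∣≡∣p∣*∣q∣ xm (ym - yn)) (ℚ.∣p*q∣≡∣p∣*∣q∣ yn (xm - xn)) ⟩
      ℚ.∣ xm ∣ * ℚ.∣ ym - yn ∣ + ℚ.∣ yn ∣ * ℚ.∣ xm - xn ∣
        ≤⟨ ℚ.+-mono-≤
             (*-mono (ℚ.0≤∣p∣ xm) (ℚ.<⇒≤ 0<η)
               (a m (⊔-left (⊔-left {M₁ ℕ.⊔ M₂} N≤m)))
               (h₂ m n (⊔-right {N₁} (⊔-right {M₁ ℕ.⊔ M₂} N≤m)) (⊔-right {N₁} (⊔-right {M₁ ℕ.⊔ M₂} N≤n))))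
             (*-mono (ℚ.0≤∣p∣ yn) (ℚ.<⇒≤ 0<η)
               (b n (⊔-right {M₁} (⊔-left {M₁ ℕ.⊔ M₂} N≤n)))
               (h₁ m n (⊔-left (⊔-right {M₁ ℕ.⊔ M₂} N≤m)) (⊔-left (⊔-right {M₁ ℕ.⊔ M₂} N≤n)))) ⟩
      A * (ε * r) + B * (ε * r)
        ≡⟨ solve 4 (λ a b e r → a :* (e :* r) :+ b :* (e :* r) := e :* ((a :+ b) :* r)) refl A B ε r ⟩
      ε * ((A + B) * r)
        ≡⟨ cong (ε *_) Cr≡1 ⟩
      ε * 1ℚ
        ≡⟨ ℚ.*-identityʳ ε ⟩
      ε ∎
    where open ℚ.≤-Reasoning

_*ℝ_ : ℝ → ℝ → ℝ
x *ℝ y = mkℝ (λ n → seq x n * seq y n) (*-cauchy {seq x} {seq y} (cauchy x) (cauchy y))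

-- climb q δ k is the largest multiple of δ, among 0, δ, …, kδ, whose
-- square is at most q (and 0 if q < 0).
climb : ℚ → ℚ → ℕ → ℚ
climb q δ zero    = 0ℚ
climb q δ (suc k) with (climb q δ k + δ) * (climb q δ k + δ) ℚ.≤? q
... | yes _ = climb q δ k + δ
... | no  _ = climb q δ k

-- The largest multiple of 1/(n+1) whose square is at most q.  The fuel is
-- sufficient because (∣numerator of q∣ + 1)² > q.
√-approx : ℕ → ℚ → ℚ
√-approx n q = climb q (1/suc n) ((ℤ.∣ ↥ q ∣ ℕ.+ 1) ℕ.* suc n)

private
  module _ (q δ : ℚ) (0<δ : 0ℚ < δ) where

    climb-nonNeg : ∀ k → 0ℚ ≤ climb q δ k
    climb-nonNeg zero = ℚ.≤-refl
    climb-nonNeg (suc k) with (climb q δ k + δ) * (climb q δ k + δ) ℚ.≤? q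
    ... | yes _ = 0≤+ (climb-nonNeg k) (ℚ.<⇒≤ 0<δ)
    ... | no  _ = climb-nonNeg k

    climb-lower : ∀ k → climb q δ k ≡ 0ℚ ⊎ climb q δ k * climb q δ k ≤ q
    climb-lower zero = inj₁ refl
    climb-lower (suc k) with (climb q δ k + δ) * (climb q δ k + δ) ℚ.≤? q
    ... | yes p = inj₂ p
    ... | no  _ = climb-lower k

    climb-upper : ∀ k → climb q δ k ≡ fromℕ k * δ ⊎ q < (climb q δ k + δ) * (climb q δ k + δ)
    climb-upper zero = inj₁ (sym (ℚ.*-zeroˡ δ))
    climb-upper (suc k) with (climb q δ k + δ) * (climb q δ k + δ) ℚ.≤? q | climb-upper k
    ... | no ¬p | _       = inj₂ (ℚ.≰⇒> ¬p)
    ... | yes p | inj₂ lt = contradiction (ℚ.<-≤-trans lt p) (ℚ.<-irrefl refl)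
    ... | yes _ | inj₁ eq = inj₁ (trans (cong (_+ δ) eq)
      (trans (solve 2 (λ a d → a :* d :+ d := (a :+ con 1ℚ) :* d) refl (fromℕ k) δ)
             (cong (_* δ) (sym (fromℕ-suc k)))))

√-approx-nonNeg : ∀ n q → 0ℚ ≤ √-approx n q
√-approx-nonNeg n q = climb-nonNeg q (1/suc n) (0<1/suc n) ((ℤ.∣ ↥ q ∣ ℕ.+ 1) ℕ.* suc n)

√-approx-lower : ∀ n q → √-approx n q ≡ 0ℚ ⊎ √-approx n q * √-approx n q ≤ q
√-approx-lower n q = climb-lower q (1/suc n) (0<1/suc n) ((ℤ.∣ ↥ q ∣ ℕ.+ 1) ℕ.* suc n)

private
  fuel-enough : ∀ q r δ K → 0ℚ ≤ δ → 0ℚ ≤ K → q ≤ K → r ≡ K + 1ℚ ⊎ q < (r + δ) * (r + δ) →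
                q < (r + δ) * (r + δ)
  fuel-enough q r δ K 0≤δ 0≤K q≤K (inj₂ lt)   = lt
  fuel-enough q r δ K 0≤δ 0≤K q≤K (inj₁ refl) = begin-strict
    q                      ≤⟨ q≤K ⟩
    K                      ≡⟨ ℚ.+-identityʳ K ⟨
    K + 0ℚ                 <⟨ ℚ.+-monoʳ-< K (ℚ.positive⁻¹ 1ℚ) ⟩
    K + 1ℚ                 ≤⟨ ≤-by (K * K + K) (0≤+ (0≤* 0≤K 0≤K) 0≤K)
                               (solve 1 (λ k → (k :+ con 1ℚ) :* (k :+ con 1ℚ)
                                 := (k :+ con 1ℚ) :+ (k :* k :+ k)) refl K) ⟩
    (K + 1ℚ) * (K + 1ℚ)    ≤⟨ *-mono 0≤K1 (0≤+ 0≤K1 0≤δ) K1≤ K1≤ ⟩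
    (r + δ) * (r + δ)      ∎
    where
    open ℚ.≤-Reasoning
    0≤K1 : 0ℚ ≤ K + 1ℚ
    0≤K1 = 0≤+ 0≤K (ℚ.<⇒≤ (ℚ.positive⁻¹ 1ℚ))
    K1≤ : K + 1ℚ ≤ K + 1ℚ + δ
    K1≤ = ≤-by δ 0≤δ refl

√-approx-upper : ∀ n q → q < (√-approx n q + 1/suc n) * (√-approx n q + 1/suc n)
√-approx-upper n q = fuel-enough q (√-approx n q) (1/suc n) (fromℕ ℤ.∣ ↥ q ∣)
  (ℚ.<⇒≤ (0<1/suc n)) (0≤fromℕ ℤ.∣ ↥ q ∣) (p≤fromℕ∣↥p∣ q)
  (map₁ (λ eq → trans eq (trans (fromℕ-*-1/suc (ℤ.∣ ↥ q ∣ ℕ.+ 1) n)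
    (trans (cong fromℕ (ℕ.+-comm ℤ.∣ ↥ q ∣ 1)) (fromℕ-suc ℤ.∣ ↥ q ∣))))
    (climb-upper q (1/suc n) (0<1/suc n) ((ℤ.∣ ↥ q ∣ ℕ.+ 1) ℕ.* suc n)))

private
  √-gap : ∀ s r δ p q h → 0ℚ ≤ s → 0ℚ ≤ r → 0ℚ ≤ δ → δ ≤ h →
          s ≡ 0ℚ ⊎ s * s ≤ p → q < (r + δ) * (r + δ) → p ≤ q + h * h → s ≤ r + (h + h)
  √-gap s r δ p q h 0≤s 0≤r 0≤δ δ≤h lower upper p≤q+h² = ℚ.≮⇒≥ λ lt → go lt lower
    where
    open ℚ.≤-Reasoning
    0≤h : 0ℚ ≤ h
    0≤h = ℚ.≤-trans 0≤δ δ≤h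
    0≤t : 0ℚ ≤ r + (h + h)
    0≤t = 0≤+ 0≤r (0≤+ 0≤h 0≤h)
    go : r + (h + h) < s → s ≡ 0ℚ ⊎ s * s ≤ p → ⊥
    go lt (inj₁ s≡0) = ℚ.<-irrefl refl (ℚ.≤-<-trans 0≤t (subst (r + (h + h) <_) s≡0 lt))
    go lt (inj₂ s²≤p) = ℚ.<-irrefl refl (begin-strict
      s * s                          ≤⟨ s²≤p ⟩
      p                              ≤⟨ p≤q+h² ⟩
      q + h * h                      <⟨ ℚ.+-monoˡ-< (h * h) upper ⟩
      (r + δ) * (r + δ) + h * h      ≤⟨ ℚ.+-monoˡ-≤ (h * h) (*-mono (0≤+ 0≤r 0≤δ)
                                          (0≤+ 0≤r 0≤h) (ℚ.+-monoʳ-≤ r δ≤h) (ℚ.+-monoʳ-≤ r δ≤h)) ⟩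
      (r + h) * (r + h) + h * h      ≤⟨ ≤-by ((r * h + r * h) + (h * h + h * h))
                                          (0≤+ (0≤+ (0≤* 0≤r 0≤h) (0≤* 0≤r 0≤h)) (0≤+ (0≤* 0≤h 0≤h) (0≤* 0≤h 0≤h)))
                                          (solve 2 (λ r h → (r :+ (h :+ h)) :* (r :+ (h :+ h))
                                            := ((r :+ h) :* (r :+ h) :+ h :* h)
                                               :+ ((r :* h :+ r :* h) :+ (h :* h :+ h :* h))) refl r h) ⟩
      (r + (h + h)) * (r + (h + h))  ≤⟨ *-mono 0≤t 0≤s (ℚ.<⇒≤ lt) (ℚ.<⇒≤ lt) ⟩
      s * s                          ∎)

  √-approx-step : ∀ m n p q h → 1/suc n ≤ h → p ≤ q + h * h → √-approx m p ≤ √-approx n q + (h + h)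
  √-approx-step m n p q h δ≤h = √-gap (√-approx m p) (√-approx n q) (1/suc n) p q h
    (√-approx-nonNeg m p) (√-approx-nonNeg n q) (ℚ.<⇒≤ (0<1/suc n)) δ≤h
    (√-approx-lower m p) (√-approx-upper n q)

abstract
  √-cauchy : ∀ {s} → IsCauchy s → IsCauchy (λ n → √-approx n (s n))
  √-cauchy {s} c ε 0<ε = ↧ₙ h ℕ.⊔ N , λ m n N≤m N≤n →
    ∣p-q∣≤r (√-approx m (s m)) (√-approx n (s n)) (step m n N≤m N≤n) (step n m N≤n N≤m)
    where
    h : ℚ
    h = ½ * ε
    0<h : 0ℚ < h
    0<h = 0<* 0<½ 0<ε
    N : ℕ
    N = proj₁ (c (h * h) (0<* 0<h 0<h))
    step : ∀ m n → ↧ₙ h ℕ.⊔ N ℕ.≤ m → ↧ₙ h ℕ.⊔ N ℕ.≤ n → √-approx m (s m) ≤ √-approx n (s n) + ε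
    step m n N≤m N≤n = subst (λ e → √-approx m (s m) ≤ √-approx n (s n) + e) (half+half ε)
      (√-approx-step m n (s m) (s n) h (archimedean h 0<h n (⊔-left {↧ₙ h} {N} N≤n))
        (∣p-q∣≤r⇒p≤q+r (s m) (s n) (proj₂ (c (h * h) (0<* 0<h 0<h)) m n
          (⊔-right {↧ₙ h} {N} N≤m) (⊔-right {↧ₙ h} {N} N≤n))))

-- The square root of a nonnegative real (0 on negative reals).
√ : ℝ → ℝ
√ x = mkℝ (λ n → √-approx n (seq x n)) (√-cauchy {seq x} (cauchy x))

√-nonNeg : ∀ x → 0ℝ ≤ℝ √ x
√-nonNeg x = mk≤ℝ λ ε 0<ε → 0 , λ n _ → 0≤+ (√-approx-nonNeg n (seq x n)) (ℚ.<⇒≤ 0<ε)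

private
  √-excess : ∀ r δ q B c ε → 0ℚ ≤ r → r ≤ B → 0ℚ ≤ δ → δ ≤ 1ℚ → 0ℚ ≤ ε * c → δ ≤ ε * c →
             (B + B + 1ℚ) * c ≡ 1ℚ → q < (r + δ) * (r + δ) → q ≤ r * r + ε
  √-excess r δ q B c ε 0≤r r≤B 0≤δ δ≤1 0≤η δ≤η Cc≡1 upper = begin
    q                                ≤⟨ ℚ.<⇒≤ upper ⟩
    (r + δ) * (r + δ)                ≡⟨ solve 2 (λ r d → (r :+ d) :* (r :+ d) := r :* r :+ (r :+ r :+ d) :* d) refl r δ ⟩
    r * r + (r + r + δ) * δ          ≤⟨ ℚ.+-monoʳ-≤ (r * r) (*-mono (0≤+ (0≤+ 0≤r 0≤r) 0≤δ) 0≤η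
                                          (ℚ.+-mono-≤ (ℚ.+-mono-≤ r≤B r≤B) δ≤1) δ≤η) ⟩
    r * r + (B + B + 1ℚ) * (ε * c)   ≡⟨ solve 4 (λ r C e c → r :* r :+ C :* (e :* c) := r :* r :+ e :* (C :* c)) refl
                                          r (B + B + 1ℚ) ε c ⟩
    r * r + ε * ((B + B + 1ℚ) * c)   ≡⟨ cong (λ z → r * r + ε * z) Cc≡1 ⟩
    r * r + ε * 1ℚ                   ≡⟨ cong (λ z → r * r + z) (ℚ.*-identityʳ ε) ⟩
    r * r + ε                        ∎
    where open ℚ.≤-Reasoning

  √-deficit : ∀ r q ε → 0ℚ ≤ ε → 0ℚ ≤ q + ε → r ≡ 0ℚ ⊎ r * r ≤ q → r * r ≤ q + ε
  √-deficit r q ε 0≤ε h (inj₁ refl) = h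
  √-deficit r q ε 0≤ε h (inj₂ le)   = ℚ.≤-trans le (≤-by ε 0≤ε refl)

  1/suc≤1 : ∀ n → 1/suc n ≤ 1ℚ
  1/suc≤1 n = /-mono-≤ (+ 1) (+ 1) (suc n) 1 (ℤ.+≤+ (ℕ.s≤s ℕ.z≤n))

√-square : ∀ x → 0ℝ ≤ℝ x → √ x *ℝ √ x ≈ℝ x
√-square x 0≤x = mk≤ℝ lower , mk≤ℝ upper
  where
  lower : ∀ ε → 0ℚ < ε → ∃[ N ] ∀ n → N ℕ.≤ n → seq (√ x *ℝ √ x) n ≤ seq x n + ε
  lower ε 0<ε = let N , h = _≤ℝ_.bound 0≤x ε 0<ε in N , λ n N≤n →
    √-deficit (√-approx n (seq x n)) (seq x n) ε (ℚ.<⇒≤ 0<ε) (h n N≤n) (√-approx-lower n (seq x n))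
  upper : ∀ ε → 0ℚ < ε → ∃[ N ] ∀ n → N ℕ.≤ n → seq x n ≤ seq (√ x *ℝ √ x) n + ε
  upper ε 0<ε =
    let B , 0<B , M , b = tailBound (cauchy (√ x))
        c , 0<c , Cc≡1  = inverse (ℚ.+-mono-< (ℚ.+-mono-< 0<B 0<B) (ℚ.positive⁻¹ 1ℚ))
        0<η             = 0<* 0<ε 0<c
    in M ℕ.⊔ ↧ₙ (ε * c) , λ n N≤n →
      √-excess (√-approx n (seq x n)) (1/suc n) (seq x n) B c ε
        (√-approx-nonNeg n (seq x n))
        (ℚ.≤-trans (p≤∣p∣ (√-approx n (seq x n))) (b n (⊔-left {M} {↧ₙ (ε * c)} N≤n)))
        (ℚ.<⇒≤ (0<1/suc n)) (1/suc≤1 n) (ℚ.<⇒≤ 0<η)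
        (archimedean (ε * c) 0<η n (⊔-right {M} {↧ₙ (ε * c)} N≤n)) Cc≡1 (√-approx-upper n (seq x n))

sumℝ : ∀ {n} → (Fin n → ℝ) → ℝ
sumℝ = foldr _+ℝ_ 0ℝ

record Graph (n : ℕ) : Set₁ where
  field
    Adj    : Rel (Fin n) 0ℓ
    adj?   : Decidable Adj
    symm   : Symmetric Adj
    irrefl : Irreflexive _≡_ Adj

-- An undirected edge is represented by its endpoints in increasing order.
record Edge {n : ℕ} (G : Graph n) : Set where
  constructor edge
  field
    src tgt  : Fin n
    .src<tgt : src Fin.< tgt
    .src~tgt : Graph.Adj G src tgt

open Edge public using (src; tgt)

adjacent : ∀ {n} {G : Graph n} (e : Edge G) → Graph.Adj G (src e) (tgt e)
adjacent {G = G} (edge u v _ u~v) = recompute (Graph.adj? G u v) u~v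

edgeTerm : ∀ {n} (G : Graph n) → (Edge G → ℝ) → ∀ u v → Dec (u Fin.< v × Graph.Adj G u v) → ℝ
edgeTerm G f u v (yes (u<v , u~v)) = f (edge u v u<v u~v)
edgeTerm G f u v (no _)            = 0ℝ

sumEdges : ∀ {n} (G : Graph n) → (Edge G → ℝ) → ℝ
sumEdges G f = sumℝ λ u → sumℝ λ v → edgeTerm G f u v ((u Fin.<? v) ×-dec Graph.adj? G u v)

IsClique : ∀ {n} → Graph n → Subset n → Set
IsClique G S = ∀ {u v} → u ∈ S → v ∈ S → u ≢ v → Graph.Adj G u v

record IsCliqueNumber {n : ℕ} (G : Graph n) (ω : ℕ) : Set where
  field
    attained : ∃[ S ] IsClique G S × ∣ S ∣ ≡ ω
    maximal  : ∀ S → IsClique G S → ∣ S ∣ ℕ.≤ ω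

-- The order in which the parts are listed is irrelevant.  By disjointness,
-- partOf v is the position of the only part containing v.
record Partition (n : ℕ) : Set where
  field
    parts    : List (Subset n)
    nonempty : All Nonempty parts
    disjoint : AllPairs (λ S T → Empty (S ∩ T)) parts
    covers   : ∀ v → Any (v ∈_) parts

  partOf : Fin n → Fin (length parts)
  partOf v = index (covers v)

PartitionAtMost : ℕ → ℕ → Set
PartitionAtMost n k = Σ (Partition n) λ P → length (Partition.parts P) ℕ.≤ k

unless : ∀ {A : Set} → Dec A → ℝ → ℝ
unless (yes _) x = 0ℝ
unless (no _)  x = x

separatedMass : ∀ {n} (G : Graph n) → Partition n → (Edge G → ℝ) → ℝ
separatedMass G P a = sumEdges G λ e → unless (partOf (src e) Fin.≟ partOf (tgt e)) (a e)
  where open Partition P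

-- A finitely supported probability distribution on A.  Outcomes may be
-- repeated, in which case their probabilities add up.
record Distribution (A : Set) : Set where
  field
    size    : ℕ
    outcome : Fin size → A
    prob    : Fin size → ℝ
    nonNeg  : ∀ i → 0ℝ ≤ℝ prob i
    total   : sumℝ prob ≈ℝ 1ℝ

expectation : ∀ {A} → Distribution A → (A → ℝ) → ℝ
expectation D X = sumℝ λ i → prob i *ℝ X (outcome i)
  where open Distribution D

module _ {n : ℕ} (G : Graph n) (e : Edge G) where

  vertices-nonZero : ℕ.NonZero n
  vertices-nonZero = Fin.nonZeroIndex (src e)

  cliqueNumber-nonTrivial : ∀ {ω} → IsCliqueNumber G ω → ℕ.NonTrivial ω
  cliqueNumber-nonTrivial isω = ℕ.n>1⇒nonTrivial (ℕ.<-≤-trans 1<∣S∣ (IsCliqueNumber.maximal isω S clique))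
    where
    open Graph G
    u = src e
    v = tgt e
    S = ⁅ u ⁆ ∪ ⁅ v ⁆
    u~v : Adj u v
    u~v = adjacent e
    u≢v : u ≢ v
    u≢v u≡v = irrefl u≡v u~v
    endpoint : ∀ {w} → w ∈ S → w ≡ u ⊎ w ≡ v
    endpoint w∈S with x∈p∪q⁻ ⁅ u ⁆ ⁅ v ⁆ w∈S
    ... | inj₁ p = inj₁ (x∈⁅y⁆⇒x≡y u p)
    ... | inj₂ p = inj₂ (x∈⁅y⁆⇒x≡y v p)
    clique : IsClique G S
    clique x∈S y∈S x≢y with endpoint x∈S | endpoint y∈S
    ... | inj₁ refl | inj₁ refl = contradiction refl x≢y
    ... | inj₁ refl | inj₂ refl = u~v
    ... | inj₂ refl | inj₁ refl = symm u~v
    ... | inj₂ refl | inj₂ refl = contradiction refl x≢y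
    1<∣S∣ : 1 ℕ.< ∣ S ∣
    1<∣S∣ = subst (ℕ._< ∣ S ∣) (∣⁅x⁆∣≡1 u)
      (p⊂q⇒∣p∣<∣q∣ (p⊆p∪q ⁅ v ⁆ , v , q⊆p∪q ⁅ u ⁆ ⁅ v ⁆ (x∈⁅x⁆ v) , λ v∈u → u≢v (sym (x∈⁅y⁆⇒x≡y u v∈u))))

denominator : (n ω : ℕ) .{{_ : ℕ.NonTrivial ω}} → ℚ
denominator n ω = (1ℚ - (+ 1 / ω) {{ℕ.nonTrivial⇒nonZero ω}}) * fromℕ (n ℕ.* n)

denominator-nonZero : (n ω : ℕ) .{{_ : ℕ.NonZero n}} .{{_ : ℕ.NonTrivial ω}} → ℚ.NonZero (denominator n ω)
denominator-nonZero (suc m) (suc (suc k)) = ℚ.pos⇒nonZero (denominator (suc m) (suc (suc k))) {{ℚ.positive (0<* 0<1-1/ω 0<n²)}}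
  where
  0<n² : 0ℚ < fromℕ (suc m ℕ.* suc m)
  0<n² = ℚ.positive⁻¹ (fromℕ (suc m ℕ.* suc m)) {{ℚ.normalize-pos (suc m ℕ.* suc m) 1}}
  0<1-1/ω : 0ℚ < 1ℚ - + 1 / suc (suc k)
  0<1-1/ω = begin-strict
    0ℚ                      <⟨ 0<½ ⟩
    1ℚ - ½                  ≤⟨ ℚ.+-monoʳ-≤ 1ℚ (ℚ.neg-antimono-≤
                                 (/-mono-≤ (+ 1) (+ 1) (suc (suc k)) 2 (ℤ.+≤+ (ℕ.s≤s (ℕ.s≤s ℕ.z≤n))))) ⟩
    1ℚ - + 1 / suc (suc k)  ∎
    where open ℚ.≤-Reasoning

coefficient : (n ω : ℕ) .{{_ : ℕ.NonZero n}} .{{_ : ℕ.NonTrivial ω}} → ℚ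
coefficient n ω = (fromℕ 2 ÷ denominator n ω) {{denominator-nonZero n ω}}

{-# OPTIONS --safe #-}
module Submission where

-- The partition is produced greedily: pick v uniformly in the current vertex set S,
-- make S ∖ N(v) a part and continue in S ∩ N(v).  The picked vertices form a clique,
-- so there are at most ω parts.  If p_uw is the probability that u and w are
-- separated, Cauchy–Schwarz reduces the theorem to Σ_{uw ∈ E} 1/p_uw ≤ (1 - 1/ω)n²/2.
--
-- Put c^S_u = |S| - Σ_{w ∈ S ∩ N(u)} 1/p^S_uw.  Conditioning on the first pick gives, for
-- w ∈ N = S ∩ N(u), with S_v = S ∩ N(v) and r_wv = p^{S_w}_uv,
--   |S| p^S_uw = c^{S_w}_u + Σ_{v ∈ N} b_wv,
-- where b_wv = 1 if v ≁ w and b_wv = 1/r_wv - 1 + r_vw if v ~ w.  Since b_wv b_vw ≥ 1, this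
-- implies |S|/c^S_u ≤ 1 + Σ_{v ∈ N} 1/c^{S_v}_u.  Summing over u, induction on the clique
-- number yields Σ_u 1/c_u ≤ ω, hence Σ_u c_u ≥ n²/ω, which is the required bound.

open import Defs
open import Algebra.Bundles using (CommutativeRing)
open import Data.Bool.Base using (Bool; true; false; not; _∧_)
import Data.Bool.Properties as Bool
open import Data.Empty using (⊥; ⊥-elim)
open import Data.Fin.Base as Fin using (Fin; zero; suc)
import Data.Fin.Properties as Fin
open import Data.Fin.Subset using (Subset; ∣_∣; _∈_; _∩_; _∪_; ⁅_⁆; Nonempty; Empty)
open import Data.Fin.Subset.Properties using (x∈⁅x⁆; x∈⁅y⁆⇒x≡y; x∈p∩q⁻; x∈p∪q⁻; p⊆p∪q; q⊆p∪q; ∣⁅x⁆∣≡1; p⊂q⇒∣p∣<∣q∣)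
import Data.Integer.Base as ℤ
import Data.Integer.Properties as ℤ
open import Data.List.Base using (List; []; _∷_; _++_; map; concat; tabulate; length; lookup)
open import Data.List.Membership.Propositional.Properties using (∈-lookup)
open import Data.List.Relation.Unary.All using (All; []; _∷_)
import Data.List.Relation.Unary.All as All
import Data.List.Relation.Unary.All.Properties as All
open import Data.List.Relation.Unary.AllPairs using (AllPairs; []; _∷_)
open import Data.List.Relation.Unary.Any using (Any; here; there; index)
open import Data.Nat.Base as ℕ using (ℕ; zero; suc)
import Data.Nat.Properties as ℕ
open import Data.Product.Base using (∃; _×_; _,_; proj₁; proj₂)
open import Data.Rational.Base as ℚ using (ℚ; 0ℚ; 1ℚ; ½; _+_; _*_; _-_; -_; 1/_; _≤_; _<_; toℚᵘ)
import Data.Rational.Properties as ℚ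
open import Data.Rational.Solver using (module +-*-Solver)
import Data.Rational.Unnormalised.Base as ℚᵘ
import Data.Rational.Unnormalised.Properties as ℚᵘ
open import Data.Sum.Base using (_⊎_; inj₁; inj₂)
import Data.Vec.Base as Vec
import Data.Vec.Properties as Vec
open import Relation.Binary.Definitions using (tri<; tri≈; tri>)
open import Relation.Binary.PropositionalEquality using (_≡_; _≢_; refl; sym; trans; cong; cong₂; subst; subst₂; module ≡-Reasoning)
open import Relation.Nullary.Decidable using (Dec; yes; no; does; dec-true; dec-false; _×-dec_)
open import Relation.Nullary.Negation using (¬_)
open import Algebra.Properties.Semiring.Sum (CommutativeRing.semiring ℚ.+-*-commutativeRing) using (sum; sum-cong-≗; sum-replicate-zero; ∑-distrib-+; ∑-comm; *-distribˡ-sum)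
open +-*-Solver using (solve; _:=_; _:+_; _:*_; _:-_; :-_; con)

-- Rational arithmetic

0≤+ : ∀ {p q} → 0ℚ ≤ p → 0ℚ ≤ q → 0ℚ ≤ p + q
0≤+ = ℚ.+-mono-≤

*-monoˡ : ∀ {p q r} → 0ℚ ≤ p → q ≤ r → p * q ≤ p * r
*-monoˡ {p} 0≤p = ℚ.*-monoˡ-≤-nonNeg p {{ℚ.nonNegative 0≤p}}

*-cancelˡ : ∀ {p q r} → 0ℚ < p → p * q ≤ p * r → q ≤ r
*-cancelˡ {p} 0<p = ℚ.*-cancelˡ-≤-pos p {{ℚ.positive 0<p}}

0≤* : ∀ {p q} → 0ℚ ≤ p → 0ℚ ≤ q → 0ℚ ≤ p * q
0≤* {p} {q} 0≤p 0≤q = subst (_≤ p * q) (ℚ.*-zeroʳ p) (*-monoˡ 0≤p 0≤q)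

0<* : ∀ {p q} → 0ℚ < p → 0ℚ < q → 0ℚ < p * q
0<* {p} {q} 0<p 0<q = ℚ.positive⁻¹ (p * q)
  {{ℚ.pos*pos⇒pos p {{ℚ.positive 0<p}} q {{ℚ.positive 0<q}}}}

0<1 : 0ℚ < 1ℚ
0<1 = ℚ.positive⁻¹ 1ℚ

0≤1 : 0ℚ ≤ 1ℚ
0≤1 = ℚ.<⇒≤ 0<1

≤-by : ∀ {p q} d → 0ℚ ≤ d → q - p ≡ d → p ≤ q
≤-by {p} {q} d 0≤d eq = subst₂ _≤_ (ℚ.+-identityʳ p)
  (trans (cong (p +_) (sym eq)) (solve 2 (λ p q → p :+ (q :- p) := q) refl p q))
  (ℚ.+-monoʳ-≤ p 0≤d)

p≤q⇒0≤q-p : ∀ {p q} → p ≤ q → 0ℚ ≤ q - p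
p≤q⇒0≤q-p {p} {q} p≤q = subst (_≤ q - p) (ℚ.+-inverseʳ p) (ℚ.+-monoˡ-≤ (- p) p≤q)

0≤square : ∀ p → 0ℚ ≤ p * p
0≤square p with ℚ.≤-total 0ℚ p
... | inj₁ 0≤p = 0≤* 0≤p 0≤p
... | inj₂ p≤0 = subst (0ℚ ≤_) (solve 1 (λ p → (:- p) :* (:- p) := p :* p) refl p)
  (0≤* (ℚ.neg-antimono-≤ p≤0) (ℚ.neg-antimono-≤ p≤0))

≤∧≢⇒< : ∀ {p q} → p ≤ q → p ≢ q → p < q
≤∧≢⇒< p≤q p≢q = ℚ.≰⇒> λ q≤p → p≢q (ℚ.≤-antisym p≤q q≤p)

-- recip 0 = 0
recip : ℚ → ℚ
recip q with q ℚ.≟ 0ℚ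
... | yes _   = 0ℚ
... | no  q≢0 = (1/ q) {{ℚ.≢-nonZero q≢0}}

*-recip : ∀ {q} → 0ℚ < q → q * recip q ≡ 1ℚ
*-recip {q} 0<q with q ℚ.≟ 0ℚ
... | yes q≡0 = ⊥-elim (ℚ.<-irrefl (sym q≡0) 0<q)
... | no  q≢0 = ℚ.*-inverseʳ q {{ℚ.≢-nonZero q≢0}}

0≤recip : ∀ {q} → 0ℚ ≤ q → 0ℚ ≤ recip q
0≤recip {q} 0≤q with q ℚ.≟ 0ℚ
... | yes _   = ℚ.≤-refl
... | no  q≢0 = ℚ.<⇒≤ (ℚ.positive⁻¹ _ {{ℚ.1/pos⇒pos q {{ℚ.positive (≤∧≢⇒< 0≤q (λ 0≡q → q≢0 (sym 0≡q)))}}}})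

-- At q = 0 the convention for `recip` makes the product 0, hence an inequality. It allows averaging
-- over a set that may be empty.
*-recip≤1 : ∀ {q} → 0ℚ ≤ q → recip q * q ≤ 1ℚ
*-recip≤1 {q} 0≤q with q ℚ.≟ 0ℚ
... | yes _   = subst (_≤ 1ℚ) (sym (ℚ.*-zeroˡ q)) 0≤1
... | no  q≢0 = ℚ.≤-reflexive (ℚ.*-inverseˡ q {{ℚ.≢-nonZero q≢0}})

recip-unique : ∀ {q r} → 0ℚ < q → q * r ≡ 1ℚ → recip q ≡ r
recip-unique {q} {r} 0<q eq = begin
  recip q            ≡⟨ ℚ.*-identityʳ (recip q) ⟨
  recip q * 1ℚ       ≡⟨ cong (recip q *_) eq ⟨
  recip q * (q * r)  ≡⟨ solve 3 (λ i q r → i :* (q :* r) := (q :* i) :* r) refl (recip q) q r ⟩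
  (q * recip q) * r  ≡⟨ cong (_* r) (*-recip 0<q) ⟩
  1ℚ * r             ≡⟨ ℚ.*-identityˡ r ⟩
  r                  ∎
  where open ≡-Reasoning

recip-≤ : ∀ {q r} → 0ℚ < q → 1ℚ ≤ q * r → recip q ≤ r
recip-≤ {q} {r} 0<q h = *-cancelˡ 0<q (subst (_≤ q * r) (sym (*-recip 0<q)) h)

1≤recip : ∀ {q} → 0ℚ < q → q ≤ 1ℚ → 1ℚ ≤ recip q
1≤recip {q} 0<q q≤1 = *-cancelˡ 0<q (subst₂ _≤_ (sym (ℚ.*-identityʳ q)) (sym (*-recip 0<q)) q≤1)

0<recip : ∀ {q} → 0ℚ < q → 0ℚ < recip q
0<recip {q} 0<q = ≤∧≢⇒< (0≤recip (ℚ.<⇒≤ 0<q)) λ 0≡r →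
  ℚ.<-irrefl (trans (sym (ℚ.*-zeroʳ q)) (trans (cong (q *_) 0≡r) (*-recip 0<q))) 0<1

-- Sums over sets of vertices

infixr 7 _▸_
_▸_ : Bool → ℚ → ℚ
true  ▸ q = q
false ▸ q = 0ℚ

-- With Boolean predicates, intersecting with a neighbourhood is a pointwise `∧`, and membership can
-- be branched on directly.
VSet : ℕ → Set
VSet n = Fin n → Bool

infixr 7 _⊓_
_⊓_ : ∀ {n} → VSet n → VSet n → VSet n
(s ⊓ t) v = s v ∧ t v

-- Elements outside `s` contribute 0 instead of being filtered out, so every such sum ranges over
-- `Fin n` and sums over different sets can be compared termwise.
∑ : ∀ {n} → VSet n → (Fin n → ℚ) → ℚ
∑ s f = sum λ v → s v ▸ f v

sum-mono : ∀ {n} {f g : Fin n → ℚ} → (∀ v → f v ≤ g v) → sum f ≤ sum g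
sum-mono {zero}  h = ℚ.≤-refl
sum-mono {suc n} h = ℚ.+-mono-≤ (h zero) (sum-mono λ v → h (suc v))

module _ {n : ℕ} where

  ∑-cong : ∀ (s : VSet n) {f g} → (∀ v → s v ≡ true → f v ≡ g v) → ∑ s f ≡ ∑ s g
  ∑-cong s {f} {g} h = sum-cong-≗ λ v → go (s v) (h v)
    where
    go : ∀ b {p q} → (b ≡ true → p ≡ q) → b ▸ p ≡ b ▸ q
    go true  e = e refl
    go false e = refl

  ∑-mono : ∀ (s : VSet n) {f g} → (∀ v → s v ≡ true → f v ≤ g v) → ∑ s f ≤ ∑ s g
  ∑-mono s {f} {g} h = sum-mono λ v → go (s v) (h v)
    where
    go : ∀ b {p q} → (b ≡ true → p ≤ q) → b ▸ p ≤ b ▸ q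
    go true  e = e refl
    go false e = ℚ.≤-refl

  ∑-zero : ∀ (s : VSet n) → ∑ s (λ _ → 0ℚ) ≡ 0ℚ
  ∑-zero s = trans (sum-cong-≗ λ v → go (s v)) (sum-replicate-zero n)
    where
    go : ∀ b → b ▸ 0ℚ ≡ 0ℚ
    go true  = refl
    go false = refl

  ∑-nonNeg : ∀ (s : VSet n) {f} → (∀ v → s v ≡ true → 0ℚ ≤ f v) → 0ℚ ≤ ∑ s f
  ∑-nonNeg s {f} h = subst (_≤ ∑ s f) (∑-zero s) (∑-mono s h)

  ∑-+ : ∀ (s : VSet n) f g → ∑ s (λ v → f v + g v) ≡ ∑ s f + ∑ s g
  ∑-+ s f g = trans (sum-cong-≗ λ v → go (s v) (f v) (g v)) (∑-distrib-+ (λ v → s v ▸ f v) (λ v → s v ▸ g v))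
    where
    go : ∀ b p q → b ▸ (p + q) ≡ b ▸ p + b ▸ q
    go true  p q = refl
    go false p q = refl

  ∑-* : ∀ (s : VSet n) p f → ∑ s (λ v → p * f v) ≡ p * ∑ s f
  ∑-* s p f = trans (sum-cong-≗ λ v → go (s v) (f v)) (sym (*-distribˡ-sum p (λ v → s v ▸ f v)))
    where
    go : ∀ b q → b ▸ (p * q) ≡ p * (b ▸ q)
    go true  q = refl
    go false q = sym (ℚ.*-zeroʳ p)

  ∑-minus : ∀ (s : VSet n) f g → ∑ s (λ v → f v - g v) ≡ ∑ s f - ∑ s g
  ∑-minus s f g = trans (∑-+ s f (λ v → - g v)) (cong (∑ s f +_)
    (trans (∑-cong s λ v _ → solve 1 (λ q → :- q := con (- 1ℚ) :* q) refl (g v))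
      (trans (∑-* s (- 1ℚ) g) (solve 1 (λ q → con (- 1ℚ) :* q := :- q) refl (∑ s g)))))

  ∑-swap : ∀ (s t : VSet n) (f : Fin n → Fin n → ℚ) → ∑ s (λ v → ∑ t (f v)) ≡ ∑ t (λ w → ∑ s λ v → f v w)
  ∑-swap s t f = trans (sum-cong-≗ λ v → push (s v) (f v)) (trans (∑-comm λ v w → s v ▸ (t w ▸ f v w))
    (sum-cong-≗ λ w → trans (sum-cong-≗ λ v → exchange (s v) (t w) (f v w)) (sym (push′ (t w) (λ v → s v ▸ f v w)))))
    where
    push : ∀ b (g : Fin n → ℚ) → b ▸ ∑ t g ≡ sum λ w → b ▸ (t w ▸ g w)
    push true  g = refl
    push false g = sym (sum-replicate-zero n)
    push′ : ∀ b (g : Fin n → ℚ) → b ▸ sum g ≡ sum λ v → b ▸ g v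
    push′ true  g = refl
    push′ false g = sym (sum-replicate-zero n)
    exchange : ∀ b c q → b ▸ (c ▸ q) ≡ c ▸ (b ▸ q)
    exchange true  true  q = refl
    exchange true  false q = refl
    exchange false true  q = refl
    exchange false false q = refl

  ∑-⊓ : ∀ (s t : VSet n) f → ∑ (s ⊓ t) f ≡ ∑ s (λ v → t v ▸ f v)
  ∑-⊓ s t f = sum-cong-≗ λ v → go (s v) (t v) (f v)
    where
    go : ∀ b c q → (b ∧ c) ▸ q ≡ b ▸ (c ▸ q)
    go true  c q = refl
    go false c q = refl

card : ∀ {n} → VSet n → ℚ
card s = ∑ s λ _ → 1ℚ

0≤card : ∀ {n} (s : VSet n) → 0ℚ ≤ card s
0≤card s = ∑-nonNeg s λ _ _ → 0≤1

∑-≥-term : ∀ {n} (s : VSet n) {f} → (∀ v → s v ≡ true → 0ℚ ≤ f v) → ∀ v → s v ≡ true → f v ≤ ∑ s f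
∑-≥-term {suc n} s {f} h zero    e rewrite e = subst (_≤ f zero + ∑ (λ v → s (suc v)) (λ v → f (suc v))) (ℚ.+-identityʳ (f zero))
  (ℚ.+-monoʳ-≤ (f zero) (∑-nonNeg (λ v → s (suc v)) λ v → h (suc v)))
∑-≥-term {suc n} s {f} h (suc v) e = subst (_≤ ∑ s f) (ℚ.+-identityˡ (f (suc v)))
  (ℚ.+-mono-≤ (go (s zero) (h zero)) (∑-≥-term (λ v → s (suc v)) (λ v → h (suc v)) v e))
  where
  go : ∀ b {q} → (b ≡ true → 0ℚ ≤ q) → 0ℚ ≤ b ▸ q
  go true  h = h refl
  go false h = ℚ.≤-refl

-- An inequality for sums of reciprocals

-- After multiplication by b the two sides differ by (bx - y)² + y²(bb′ - 1).
weighted-AM-GM : ∀ {b b′} x y → 0ℚ < b → 1ℚ ≤ b * b′ → x * y + x * y ≤ x * x * b + y * y * b′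
weighted-AM-GM {b} {b′} x y 0<b h = *-cancelˡ 0<b (≤-by _
  (0≤+ (0≤square (b * x - y)) (0≤* (0≤square y) (p≤q⇒0≤q-p h)))
  (solve 4 (λ b c x y → b :* (x :* x :* b :+ y :* y :* c) :- b :* (x :* y :+ x :* y)
    := (b :* x :- y) :* (b :* x :- y) :+ y :* y :* (b :* c :- con 1ℚ)) refl b b′ x y))

module _ {n : ℕ} (N : VSet n) (c d : Fin n → ℚ) (b : Fin n → Fin n → ℚ) where

  private
    ξ = λ w → recip (d w)
    X = ∑ N ξ
    A = ∑ N λ w → recip (c w)
    t = recip (1ℚ + A)

  -- With ξ = 1/d one has X = Σ ξ²d = Σ ξ²c + ΣΣ ξ_w²b_wv.  Here the double sum is at
  -- least X², and Σ ξ²c ≥ 2tX - t²A for every t; the choice t = 1/(1 + A) makes the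
  -- resulting quadratic inequality read (X - (1 - t))(X + t) ≤ 0.
  parallel-sum : (∀ w → N w ≡ true → 0ℚ < c w) → (∀ w → N w ≡ true → 0ℚ < d w) →
    (∀ w → N w ≡ true → d w ≡ c w + ∑ N (b w)) →
    (∀ w v → N w ≡ true → N v ≡ true → 0ℚ < b w v) →
    (∀ w v → N w ≡ true → N v ≡ true → 1ℚ ≤ b w v * b v w) →
    ∑ N (λ w → recip (d w)) ≤ 1ℚ - recip (1ℚ + ∑ N λ w → recip (c w))
  -- If X exceeded 1 - t, both factors in `quadratic` would be positive, since X ≥ 0 and t > 0.
  parallel-sum 0<c 0<d d≡ 0<b 1≤bb = ℚ.≮⇒≥ λ 1-t<X →
    ℚ.<-irrefl refl (ℚ.<-≤-trans (0<* (0<diff 1-t<X) 0<X+t) quadratic)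
    where
    open ℚ.≤-Reasoning
    0≤ξ : ∀ w → N w ≡ true → 0ℚ ≤ ξ w
    0≤ξ w e = 0≤recip (ℚ.<⇒≤ (0<d w e))
    0≤A : 0ℚ ≤ A
    0≤A = ∑-nonNeg N λ w e → 0≤recip (ℚ.<⇒≤ (0<c w e))
    0<1+A : 0ℚ < 1ℚ + A
    0<1+A = ℚ.+-mono-<-≤ 0<1 0≤A
    0<X+t : 0ℚ < X + t
    0<X+t = ℚ.+-mono-≤-< (∑-nonNeg N 0≤ξ) (0<recip 0<1+A)
    0<diff : ∀ {p q} → p < q → 0ℚ < q - p
    0<diff {p} {q} p<q = subst (_< q - p) (ℚ.+-inverseʳ p) (ℚ.+-monoˡ-< (- p) p<q)
    B = ∑ N λ w → ∑ N λ v → ξ w * ξ w * b w v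
    B′ = ∑ N λ w → ∑ N λ v → ξ w * ξ v
    X²≡B′ : X * X ≡ B′
    X²≡B′ = trans (sym (∑-* N X ξ)) (∑-cong N λ w _ →
      trans (ℚ.*-comm X (ξ w)) (sym (∑-* N (ξ w) ξ)))
    -- Pair (w, v) with (v, w): by `weighted-AM-GM`, 2ξ_wξ_v ≤ ξ_w²b_wv + ξ_v²b_vw, and exchanging
    -- the sums shows that each half on the right adds up to B.
    X²≤B : X * X ≤ B
    X²≤B = *-cancelˡ (0<* {1ℚ + 1ℚ} {1ℚ} (ℚ.positive⁻¹ (1ℚ + 1ℚ)) 0<1) (begin
      (1ℚ + 1ℚ) * 1ℚ * (X * X)
        ≡⟨ cong (((1ℚ + 1ℚ) * 1ℚ) *_) X²≡B′ ⟩
      (1ℚ + 1ℚ) * 1ℚ * B′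
        ≡⟨ solve 1 (λ x → (con 1ℚ :+ con 1ℚ) :* con 1ℚ :* x := x :+ x) refl B′ ⟩
      B′ + B′
        ≡⟨ trans (∑-cong N λ w _ → ∑-+ N _ _) (∑-+ N _ _) ⟨
      ∑ N (λ w → ∑ N λ v → ξ w * ξ v + ξ w * ξ v)
        ≤⟨ (∑-mono N λ w ew → ∑-mono N λ v ev → weighted-AM-GM (ξ w) (ξ v) (0<b w v ew ev) (1≤bb w v ew ev)) ⟩
      ∑ N (λ w → ∑ N λ v → ξ w * ξ w * b w v + ξ v * ξ v * b v w)
        ≡⟨ trans (∑-cong N λ w _ → ∑-+ N _ _) (∑-+ N _ _) ⟩
      B + ∑ N (λ w → ∑ N λ v → ξ v * ξ v * b v w)
        ≡⟨ cong (B +_) (∑-swap N N (λ w v → ξ v * ξ v * b v w)) ⟩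
      B + B
        ≡⟨ solve 1 (λ x → (con 1ℚ :+ con 1ℚ) :* con 1ℚ :* x := x :+ x) refl B ⟨
      (1ℚ + 1ℚ) * 1ℚ * B ∎)
    C = ∑ N λ w → ξ w * ξ w * c w
    X≡C+B : X ≡ C + B
    X≡C+B = trans (∑-cong N λ w e → begin-equality
        ξ w                                       ≡⟨ ℚ.*-identityʳ (ξ w) ⟨
        ξ w * 1ℚ                                  ≡⟨ cong (ξ w *_) (*-recip (0<d w e)) ⟨
        ξ w * (d w * ξ w)                         ≡⟨ cong (λ z → ξ w * (z * ξ w)) (d≡ w e) ⟩
        ξ w * ((c w + ∑ N (b w)) * ξ w)           ≡⟨ solve 3 (λ x c s → x :* ((c :+ s) :* x) := x :* x :* c :+ x :* x :* s)
                                                       refl (ξ w) (c w) (∑ N (b w)) ⟩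
        ξ w * ξ w * c w + ξ w * ξ w * ∑ N (b w)   ≡⟨ cong (ξ w * ξ w * c w +_) (∑-* N (ξ w * ξ w) (b w)) ⟨
        ξ w * ξ w * c w + ∑ N (λ v → ξ w * ξ w * b w v) ∎)
      (∑-+ N _ _)
    -- The right side is convex in ξ and lies above its tangent at ξ = t/c; multiplied by c, the
    -- difference is (cξ - t)².
    tangent : ∀ w → N w ≡ true → (t + t) * ξ w - t * t * recip (c w) ≤ ξ w * ξ w * c w
    tangent w e = *-cancelˡ (0<c w e) (≤-by _ (0≤square (c w * ξ w - t)) (begin-equality
      c w * (ξ w * ξ w * c w) - c w * ((t + t) * ξ w - t * t * recip (c w))
        ≡⟨ solve 4 (λ c x t r → c :* (x :* x :* c) :- c :* ((t :+ t) :* x :- t :* t :* r)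
             := c :* x :* (c :* x) :- (t :+ t) :* (c :* x) :+ t :* t :* (c :* r)) refl (c w) (ξ w) t (recip (c w)) ⟩
      c w * ξ w * (c w * ξ w) - (t + t) * (c w * ξ w) + t * t * (c w * recip (c w))
        ≡⟨ cong (λ z → c w * ξ w * (c w * ξ w) - (t + t) * (c w * ξ w) + t * t * z) (*-recip (0<c w e)) ⟩
      c w * ξ w * (c w * ξ w) - (t + t) * (c w * ξ w) + t * t * 1ℚ
        ≡⟨ solve 2 (λ y t → y :* y :- (t :+ t) :* y :+ t :* t :* con 1ℚ := (y :- t) :* (y :- t)) refl (c w * ξ w) t ⟩
      (c w * ξ w - t) * (c w * ξ w - t) ∎))
    C≥ : (t + t) * X - t * t * A ≤ C
    C≥ = begin
      (t + t) * X - t * t * A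
        ≡⟨ cong₂ _-_ (∑-* N (t + t) ξ) (∑-* N (t * t) (λ w → recip (c w))) ⟨
      ∑ N (λ w → (t + t) * ξ w) - ∑ N (λ w → t * t * recip (c w))
        ≡⟨ ∑-minus N _ _ ⟨
      ∑ N (λ w → (t + t) * ξ w - t * t * recip (c w))
        ≤⟨ ∑-mono N tangent ⟩
      C ∎
    -- The choice of t gives (1 + A)t = 1, that is, tA = 1 - t.
    ttA : t * t * A ≡ t * (1ℚ - t)
    ttA = begin-equality
      t * t * A                          ≡⟨ solve 2 (λ t a → t :* t :* a := t :* ((con 1ℚ :+ a) :* t :- t)) refl t A ⟩
      t * ((1ℚ + A) * t - t)             ≡⟨ cong (λ z → t * (z - t)) (*-recip 0<1+A) ⟩
      t * (1ℚ - t)                       ∎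
    quadratic : (X - (1ℚ - t)) * (X + t) ≤ 0ℚ
    quadratic = begin
      (X - (1ℚ - t)) * (X + t)
        ≡⟨ solve 2 (λ x t → (x :- (con 1ℚ :- t)) :* (x :+ t)
             := ((t :+ t) :* x :- t :* (con 1ℚ :- t)) :+ x :* x :- x) refl X t ⟩
      ((t + t) * X - t * (1ℚ - t)) + X * X - X
        ≡⟨ cong (λ z → ((t + t) * X - z) + X * X - X) ttA ⟨
      ((t + t) * X - t * t * A) + X * X - X
        ≤⟨ ℚ.+-monoˡ-≤ (- X) (ℚ.+-mono-≤ C≥ X²≤B) ⟩
      C + B - X
        ≡⟨ cong (_- X) X≡C+B ⟨
      X - X
        ≡⟨ ℚ.+-inverseʳ X ⟩
      0ℚ ∎

fromℕ-suc : ∀ n → fromℕ (suc n) ≡ 1ℚ + fromℕ n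
fromℕ-suc n = ℚ.toℚᵘ-injective (begin
  toℚᵘ (fromℕ (suc n))             ≈⟨ ℚ.toℚᵘ-fromℚᵘ (ℚᵘ.mkℚᵘ (ℤ.+ suc n) 0) ⟩
  ℚᵘ.mkℚᵘ (ℤ.+ suc n) 0            ≈⟨ ℚᵘ.*≡* (cong (λ i → (ℤ.+ 1 ℤ.+ i) ℤ.* ℤ.+ 1) (sym (ℤ.*-identityʳ (ℤ.+ n)))) ⟩
  ℚᵘ.1ℚᵘ ℚᵘ.+ ℚᵘ.mkℚᵘ (ℤ.+ n) 0    ≈⟨ ℚᵘ.+-congʳ ℚᵘ.1ℚᵘ (ℚ.toℚᵘ-fromℚᵘ (ℚᵘ.mkℚᵘ (ℤ.+ n) 0)) ⟨
  ℚᵘ.1ℚᵘ ℚᵘ.+ toℚᵘ (fromℕ n)       ≈⟨ ℚ.toℚᵘ-homo-+ 1ℚ (fromℕ n) ⟨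
  toℚᵘ (1ℚ + fromℕ n)              ∎)
  where open ℚᵘ.≃-Reasoning

-- split (v ~ u) (v ~ w) q is the probability that u and w get separated once v has been
-- picked, where q is that probability for the remaining process.
split : Bool → Bool → ℚ → ℚ
split true  true  q = q
split true  false q = 1ℚ
split false true  q = 1ℚ
split false false q = 0ℚ

split-sym : ∀ a b {q r} → q ≡ r → split a b q ≡ split b a r
split-sym true  true  e = e
split-sym true  false e = refl
split-sym false true  e = refl
split-sym false false e = refl

split-nonNeg : ∀ a b {q} → (a ≡ true → b ≡ true → 0ℚ ≤ q) → 0ℚ ≤ split a b q
split-nonNeg true  true  h = h refl refl
split-nonNeg true  false h = 0≤1
split-nonNeg false true  h = 0≤1
split-nonNeg false false h = ℚ.≤-refl

split≤1 : ∀ a b {q} → (a ≡ true → b ≡ true → q ≤ 1ℚ) → split a b q ≤ 1ℚ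
split≤1 true  true  h = h refl refl
split≤1 true  false h = ℚ.≤-refl
split≤1 false true  h = ℚ.≤-refl
split≤1 false false h = 0≤1

∧-intro : ∀ {a b} → a ≡ true → b ≡ true → a ∧ b ≡ true
∧-intro refl refl = refl

∧-left : ∀ {a b} → a ∧ b ≡ true → a ≡ true
∧-left {a} {b} = Bool.∧-conicalˡ a b

∧-right : ∀ {a b} → a ∧ b ≡ true → b ≡ true
∧-right {a} {b} = Bool.∧-conicalʳ a b

-- Bounds for the greedy process

module Greedy {n : ℕ} (G : Graph n) where
  open Graph G using (Adj; adj?; symm; irrefl)

  adj : Fin n → VSet n
  adj u v = does (adj? u v)

  adj⇒Adj : ∀ {u v} → adj u v ≡ true → Adj u v
  adj⇒Adj {u} {v} e with adj? u v
  ... | yes p = p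

  Adj⇒adj : ∀ {u v} → Adj u v → adj u v ≡ true
  Adj⇒adj {u} {v} p = dec-true (adj? u v) p

  adj-irrefl : ∀ u → adj u u ≡ false
  adj-irrefl u = dec-false (adj? u u) (irrefl refl)

  adj-sym : ∀ u v → adj u v ≡ adj v u
  adj-sym u v with adj? u v
  ... | yes p = sym (Adj⇒adj (symm p))
  ... | no ¬p = sym (dec-false (adj? v u) λ q → ¬p (symm q))

  -- Cliques are taken in `G` and merely required to lie in `s`, so no induced subgraph has to be
  -- formed. An upper bound, unlike the exact clique number, passes to neighbourhoods with a
  -- decrease of exactly one.
  CliqueBound : ℕ → VSet n → Set
  CliqueBound k s = ∀ T → IsClique G T → (∀ {v} → v ∈ T → s v ≡ true) → ∣ T ∣ ℕ.≤ k

  -- A single vertex is already a clique of size 1.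
  cliqueBound-zero : ∀ {s} → CliqueBound 0 s → ∀ v → s v ≡ true → ⊥
  cliqueBound-zero {s} cb v sv with ∣ ⁅ v ⁆ ∣ | ∣⁅x⁆∣≡1 v | cb ⁅ v ⁆ single inside
    where
    single : IsClique G ⁅ v ⁆
    single x∈ y∈ x≢y = ⊥-elim (x≢y (trans (x∈⁅y⁆⇒x≡y v x∈) (sym (x∈⁅y⁆⇒x≡y v y∈))))
    inside : ∀ {x} → x ∈ ⁅ v ⁆ → s x ≡ true
    inside x∈ rewrite x∈⁅y⁆⇒x≡y v x∈ = sv
  ... | .1 | refl | ()

  -- Adding v to a clique inside its neighbourhood gives a strictly larger clique of `s`, because v
  -- is not its own neighbour.
  cliqueBound-suc : ∀ {k s} → CliqueBound (suc k) s → ∀ v → s v ≡ true → CliqueBound k (s ⊓ adj v)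
  cliqueBound-suc {k} {s} cb v sv T clique inside = ℕ.≤-pred (ℕ.<-≤-trans
    (p⊂q⇒∣p∣<∣q∣ (p⊆p∪q ⁅ v ⁆ , v , q⊆p∪q T ⁅ v ⁆ (x∈⁅x⁆ v) , v∉T)) (cb (T ∪ ⁅ v ⁆) clique′ inside′))
    where
    v∉T : v ∈ T → ⊥
    v∉T v∈T with trans (sym (adj-irrefl v)) (∧-right {s v} (inside v∈T))
    ... | ()
    clique′ : IsClique G (T ∪ ⁅ v ⁆)
    clique′ {x} {y} x∈ y∈ x≢y with x∈p∪q⁻ T ⁅ v ⁆ x∈ | x∈p∪q⁻ T ⁅ v ⁆ y∈
    ... | inj₁ x∈T | inj₁ y∈T = clique x∈T y∈T x≢y
    ... | inj₁ x∈T | inj₂ y∈v rewrite x∈⁅y⁆⇒x≡y v y∈v = symm (adj⇒Adj (∧-right {s x} (inside x∈T)))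
    ... | inj₂ x∈v | inj₁ y∈T rewrite x∈⁅y⁆⇒x≡y v x∈v = adj⇒Adj (∧-right {s y} (inside y∈T))
    ... | inj₂ x∈v | inj₂ y∈v = ⊥-elim (x≢y (trans (x∈⁅y⁆⇒x≡y v x∈v) (sym (x∈⁅y⁆⇒x≡y v y∈v))))
    inside′ : ∀ {x} → x ∈ T ∪ ⁅ v ⁆ → s x ≡ true
    inside′ {x} x∈ with x∈p∪q⁻ T ⁅ v ⁆ x∈
    ... | inj₁ x∈T = ∧-left (inside x∈T)
    ... | inj₂ x∈v rewrite x∈⁅y⁆⇒x≡y v x∈v = sv

  -- The number k is fuel; any bound on the clique number of s is enough.
  sepProb : ℕ → VSet n → Fin n → Fin n → ℚ
  sepProb zero    s u w = 0ℚ
  sepProb (suc k) s u w = recip (card s) * ∑ s λ v → split (adj v u) (adj v w) (sepProb k (s ⊓ adj v) u w)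

  sepProb-sym : ∀ k s u w → sepProb k s u w ≡ sepProb k s w u
  sepProb-sym zero    s u w = refl
  sepProb-sym (suc k) s u w = cong (recip (card s) *_) (∑-cong s λ v _ →
    split-sym (adj v u) (adj v w) (sepProb-sym k (s ⊓ adj v) u w))

  -- The quantity c^S_u of the overview. Summed over u in `s`, it gives |s|² minus the sum of 1/p
  -- over ordered adjacent pairs, so a lower bound on the gaps is an upper bound on that sum.
  gap : ℕ → VSet n → Fin n → ℚ
  gap k s u = card s - ∑ (s ⊓ adj u) λ w → recip (sepProb k s u w)

  card-pos : ∀ (s : VSet n) v → s v ≡ true → 0ℚ < card s
  card-pos s v sv = ℚ.<-≤-trans 0<1 (∑-≥-term s (λ _ _ → 0≤1) v sv)

  -- The induction hypothesis. `gap-sum` is the estimate wanted; the other fields make each `recip`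
  -- involved a true inverse and supply the hypotheses of `coupling-product` and `parallel-sum` one
  -- level up.
  record Bounds (k : ℕ) (s : VSet n) : Set where
    field
      sep-pos : ∀ u w → s u ≡ true → s w ≡ true → adj u w ≡ true → 0ℚ < sepProb k s u w
      sep≤1   : ∀ u w → s u ≡ true → s w ≡ true → adj u w ≡ true → sepProb k s u w ≤ 1ℚ
      gap-pos : ∀ u → s u ≡ true → 0ℚ < gap k s u
      gap-sum : ∑ s (λ u → recip (gap k s u)) ≤ fromℕ k

  -- The product exceeds 1 by (1/r - 1)(1/q - 1) + (1 - r)(1 - q).
  coupling-product : ∀ {r q} → 0ℚ < r → r ≤ 1ℚ → 0ℚ < q → q ≤ 1ℚ →
    1ℚ ≤ (recip r - 1ℚ + q) * (recip q - 1ℚ + r)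
  coupling-product {r} {q} 0<r r≤1 0<q q≤1 = ≤-by _
    (0≤+ (0≤* (p≤q⇒0≤q-p (1≤recip 0<r r≤1)) (p≤q⇒0≤q-p (1≤recip 0<q q≤1)))
         (0≤* (p≤q⇒0≤q-p r≤1) (p≤q⇒0≤q-p q≤1)))
    (begin
      (R - 1ℚ + q) * (Q - 1ℚ + r) - 1ℚ
        ≡⟨ solve 4 (λ r q R Q → (R :- con 1ℚ :+ q) :* (Q :- con 1ℚ :+ r) :- con 1ℚ
             := (R :- con 1ℚ) :* (Q :- con 1ℚ) :+ (r :* R :- r :+ (q :* Q :- q) :+ q :* r :- con 1ℚ)) refl r q R Q ⟩
      (R - 1ℚ) * (Q - 1ℚ) + (r * R - r + (q * Q - q) + q * r - 1ℚ)
        ≡⟨ cong₂ (λ x y → (R - 1ℚ) * (Q - 1ℚ) + (x - r + (y - q) + q * r - 1ℚ)) (*-recip 0<r) (*-recip 0<q) ⟩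
      (R - 1ℚ) * (Q - 1ℚ) + (1ℚ - r + (1ℚ - q) + q * r - 1ℚ)
        ≡⟨ cong ((R - 1ℚ) * (Q - 1ℚ) +_) (solve 2 (λ r q → con 1ℚ :- r :+ (con 1ℚ :- q) :+ q :* r :- con 1ℚ
             := (con 1ℚ :- r) :* (con 1ℚ :- q)) refl r q) ⟩
      (R - 1ℚ) * (Q - 1ℚ) + (1ℚ - r) * (1ℚ - q) ∎)
    where
    open ≡-Reasoning
    R = recip r
    Q = recip q

  -- The inductive step: conditioning on the first pick

  module Step (k : ℕ) (s : VSet n) (ih : ∀ v → s v ≡ true → Bounds k (s ⊓ adj v)) where

    inner : Fin n → Fin n → Fin n → ℚ
    inner v u w = sepProb k (s ⊓ adj v) u w

    -- This is |s| times the separation probability, as `recip-sep` records; the recursion for it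
    -- involves no division by |s|.
    total : Fin n → Fin n → ℚ
    total u w = ∑ s λ v → split (adj v u) (adj v w) (inner v u w)

    module _ {u w} (su : s u ≡ true) (sw : s w ≡ true) (uw : adj u w ≡ true) where

      inner-pos : ∀ v → s v ≡ true → adj v u ≡ true → adj v w ≡ true → 0ℚ < inner v u w
      inner-pos v sv vu vw = Bounds.sep-pos (ih v sv) u w (∧-intro su vu) (∧-intro sw vw) uw

      inner≤1 : ∀ v → s v ≡ true → adj v u ≡ true → adj v w ≡ true → inner v u w ≤ 1ℚ
      inner≤1 v sv vu vw = Bounds.sep≤1 (ih v sv) u w (∧-intro su vu) (∧-intro sw vw) uw

      -- The pick v = u alone contributes 1: u is adjacent to w but not to itself.
      total-pos : 0ℚ < total u w
      total-pos = ℚ.<-≤-trans 0<1 (subst (_≤ total u w) u-splits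
        (∑-≥-term s (λ v sv → split-nonNeg (adj v u) (adj v w) λ vu vw → ℚ.<⇒≤ (inner-pos v sv vu vw)) u su))
        where
        u-splits : split (adj u u) (adj u w) (inner u u w) ≡ 1ℚ
        u-splits rewrite adj-irrefl u | uw = refl

      sep-pos : 0ℚ < sepProb (suc k) s u w
      sep-pos = 0<* (0<recip (card-pos s u su)) total-pos

      sep≤1 : sepProb (suc k) s u w ≤ 1ℚ
      sep≤1 = ℚ.≤-trans (*-monoˡ (0≤recip (ℚ.<⇒≤ (card-pos s u su)))
        (∑-mono s λ v sv → split≤1 (adj v u) (adj v w) (inner≤1 v sv)))
        (*-recip≤1 (ℚ.<⇒≤ (card-pos s u su)))

      recip-sep : recip (sepProb (suc k) s u w) ≡ card s * recip (total u w)
      recip-sep = recip-unique sep-pos (begin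
        recip (card s) * total u w * (card s * recip (total u w))
          ≡⟨ solve 4 (λ i t c r → i :* t :* (c :* r) := (c :* i) :* (t :* r)) refl
               (recip (card s)) (total u w) (card s) (recip (total u w)) ⟩
        (card s * recip (card s)) * (total u w * recip (total u w))
          ≡⟨ cong₂ _*_ (*-recip (card-pos s u su)) (*-recip total-pos) ⟩
        1ℚ * 1ℚ
          ≡⟨⟩
        1ℚ ∎)
        where open ≡-Reasoning

    module _ {u} (su : s u ≡ true) where

      N : VSet n
      N = s ⊓ adj u

      c : Fin n → ℚ
      c w = gap k (s ⊓ adj w) u

      -- The coefficient b_wv of the overview, with the Boolean telling whether w ~ v, r = r_wv and
      -- q = r_vw.
      couple : Bool → ℚ → ℚ → ℚ
      couple true  r q = recip r - 1ℚ + q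
      couple false r q = 1ℚ

      b : Fin n → Fin n → ℚ
      b w v = couple (adj w v) (inner w u v) (inner v u w)

      flip-adj : ∀ {w} → N w ≡ true → adj w u ≡ true
      flip-adj {w} Nw = trans (adj-sym w u) (∧-right {s w} Nw)

      c-pos : ∀ w → N w ≡ true → 0ℚ < c w
      c-pos w Nw = Bounds.gap-pos (ih w (∧-left Nw)) u (∧-intro su (flip-adj Nw))

      -- Compare the contributions of each v in `s`. If v is adjacent to both u and w, the right
      -- side gives 1 - 1/r + (1/r - 1 + q) = q; if to exactly one of them, 1; if to neither, 0.
      -- These are the values of `split`.
      total≡ : ∀ w → N w ≡ true → total u w ≡ c w + ∑ N (b w)
      total≡ w Nw = begin
        total u w
          ≡⟨ ∑-cong s (λ v _ → pointwise v) ⟩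
        ∑ s (λ v → (adj w v ▸ 1ℚ - adj w v ▸ (adj u v ▸ recip (inner w u v))) + adj u v ▸ b w v)
          ≡⟨ ∑-+ s _ _ ⟩
        ∑ s (λ v → adj w v ▸ 1ℚ - adj w v ▸ (adj u v ▸ recip (inner w u v))) + ∑ s (λ v → adj u v ▸ b w v)
          ≡⟨ cong₂ _+_ (∑-minus s _ _) (sym (∑-⊓ s (adj u) (b w))) ⟩
        ∑ s (λ v → adj w v ▸ 1ℚ) - ∑ s (λ v → adj w v ▸ (adj u v ▸ recip (inner w u v))) + ∑ N (b w)
          ≡⟨ cong (_+ ∑ N (b w)) (cong₂ _-_ (sym (∑-⊓ s (adj w) (λ _ → 1ℚ)))
               (trans (sym (∑-⊓ s (adj w) (λ v → adj u v ▸ recip (inner w u v))))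
                 (sym (∑-⊓ (s ⊓ adj w) (adj u) (λ v → recip (inner w u v)))))) ⟩
        c w + ∑ N (b w) ∎
        where
        open ≡-Reasoning
        go : ∀ α β r q → split α β q ≡ (β ▸ 1ℚ - β ▸ (α ▸ recip r)) + α ▸ couple β r q
        go true  true  r q = solve 2 (λ R q → q := con 1ℚ :- R :+ (R :- con 1ℚ :+ q)) refl (recip r) q
        go true  false r q = refl
        go false true  r q = refl
        go false false r q = refl
        pointwise : ∀ v → split (adj v u) (adj v w) (inner v u w) ≡
          (adj w v ▸ 1ℚ - adj w v ▸ (adj u v ▸ recip (inner w u v))) + adj u v ▸ b w v
        pointwise v rewrite adj-sym v u | adj-sym v w = go (adj u v) (adj w v) (inner w u v) (inner v u w)

      module _ {w v} (Nw : N w ≡ true) (Nv : N v ≡ true) (wv : adj w v ≡ true) where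

        link-pos : 0ℚ < inner w u v
        link-pos = inner-pos su (∧-left Nv) (∧-right {s v} Nv) w (∧-left Nw) (flip-adj Nw) wv

        link≤1 : inner w u v ≤ 1ℚ
        link≤1 = inner≤1 su (∧-left Nv) (∧-right {s v} Nv) w (∧-left Nw) (flip-adj Nw) wv

      b-pos : ∀ w v → N w ≡ true → N v ≡ true → 0ℚ < b w v
      b-pos w v Nw Nv = go (adj w v) refl
        where
        go : ∀ β → adj w v ≡ β → 0ℚ < couple β (inner w u v) (inner v u w)
        go false _  = 0<1
        go true  wv = ℚ.+-mono-≤-< (p≤q⇒0≤q-p (1≤recip (link-pos Nw Nv wv) (link≤1 Nw Nv wv)))
          (link-pos Nv Nw (trans (adj-sym v w) wv))

      1≤bb : ∀ w v → N w ≡ true → N v ≡ true → 1ℚ ≤ b w v * b v w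
      -- The rewrite makes both factors branch on the same Boolean. The diagonal w = v falls under
      -- the nonadjacent case, where the product is 1.
      1≤bb w v Nw Nv rewrite adj-sym v w = go (adj w v) refl
        where
        go : ∀ β → adj w v ≡ β →
          1ℚ ≤ couple β (inner w u v) (inner v u w) * couple β (inner v u w) (inner w u v)
        go false _  = ℚ.≤-refl
        go true  wv = coupling-product (link-pos Nw Nv wv) (link≤1 Nw Nv wv) (link-pos Nv Nw vw) (link≤1 Nv Nw vw)
          where vw = trans (adj-sym v w) wv

      A : ℚ
      A = ∑ N λ w → recip (c w)

      0<1+A : 0ℚ < 1ℚ + A
      0<1+A = ℚ.+-mono-<-≤ 0<1 (∑-nonNeg N λ w Nw → 0≤recip (ℚ.<⇒≤ (c-pos w Nw)))

      -- By `recip-sep`, the sum subtracted in the gap is |s| times the sum of 1/`total`, and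
      -- `parallel-sum` bounds the latter by 1 - 1/(1 + A).
      gap-lower : card s * recip (1ℚ + A) ≤ gap (suc k) s u
      gap-lower = begin
        card s * recip (1ℚ + A)
          ≡⟨ solve 2 (λ m t → m :* t := m :- m :* (con 1ℚ :- t)) refl (card s) (recip (1ℚ + A)) ⟩
        card s - card s * (1ℚ - recip (1ℚ + A))
          ≤⟨ ℚ.+-monoʳ-≤ (card s) (ℚ.neg-antimono-≤ (*-monoˡ (ℚ.<⇒≤ (card-pos s u su))
               (parallel-sum N c (total u) b c-pos
                 (λ w Nw → total-pos su (∧-left Nw) (∧-right {s w} Nw)) total≡ b-pos 1≤bb))) ⟩
        card s - card s * ∑ N (λ w → recip (total u w))
          ≡⟨ cong (λ z → card s - z) (trans (sym (∑-* N (card s) (λ w → recip (total u w))))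
               (∑-cong N λ w Nw → sym (recip-sep su (∧-left Nw) (∧-right {s w} Nw)))) ⟩
        gap (suc k) s u ∎
        where open ℚ.≤-Reasoning

      gap-pos : 0ℚ < gap (suc k) s u
      gap-pos = ℚ.<-≤-trans (0<* (card-pos s u su) (0<recip 0<1+A)) gap-lower

      -- Inverting `gap-lower` gives the recursive inequality for 1/c^S_u.
      recip-gap≤ : recip (gap (suc k) s u) ≤ recip (card s) * (1ℚ + A)
      recip-gap≤ = recip-≤ gap-pos (begin
        1ℚ
          ≡⟨⟩
        1ℚ * 1ℚ
          ≡⟨ cong₂ _*_ (*-recip (card-pos s u su)) (*-recip 0<1+A) ⟨
        (card s * recip (card s)) * ((1ℚ + A) * recip (1ℚ + A))
          ≡⟨ solve 4 (λ m i a t → (m :* i) :* (a :* t) := (i :* a) :* (m :* t)) refl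
               (card s) (recip (card s)) (1ℚ + A) (recip (1ℚ + A)) ⟩
        (recip (card s) * (1ℚ + A)) * (card s * recip (1ℚ + A))
          ≤⟨ *-monoˡ (0≤* (0≤recip (ℚ.<⇒≤ (card-pos s u su))) (ℚ.<⇒≤ 0<1+A)) gap-lower ⟩
        (recip (card s) * (1ℚ + A)) * gap (suc k) s u
          ≡⟨ ℚ.*-comm (recip (card s) * (1ℚ + A)) (gap (suc k) s u) ⟩
        gap (suc k) s u * (recip (card s) * (1ℚ + A)) ∎)
        where open ℚ.≤-Reasoning

    -- The same sum as `A`, but free of the proof that u lies in `s`, so that it can be summed over
    -- u.
    B : Fin n → ℚ
    B u = ∑ (s ⊓ adj u) λ v → recip (gap k (s ⊓ adj v) u)

    -- Sum `recip-gap≤` over u and regroup by the picked vertex v, using the symmetry of adjacency.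
    -- The group of v is the sum of reciprocal gaps in `s ⊓ adj v`, at most k by induction, so the
    -- whole is at most (|s| + k|s|)/|s|.
    gap-sum : ∑ s (λ u → recip (gap (suc k) s u)) ≤ fromℕ (suc k)
    gap-sum = begin
      ∑ s (λ u → recip (gap (suc k) s u))
        ≤⟨ ∑-mono s (λ u su → recip-gap≤ su) ⟩
      ∑ s (λ u → recip (card s) * (1ℚ + B u))
        ≡⟨ ∑-* s (recip (card s)) (λ u → 1ℚ + B u) ⟩
      recip (card s) * ∑ s (λ u → 1ℚ + B u)
        ≤⟨ *-monoˡ (0≤recip (0≤card s)) links ⟩
      recip (card s) * (card s * fromℕ (suc k))
        ≡⟨ solve 3 (λ i m k → i :* (m :* k) := k :* (i :* m)) refl (recip (card s)) (card s) (fromℕ (suc k)) ⟩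
      fromℕ (suc k) * (recip (card s) * card s)
        ≤⟨ *-monoˡ (ℚ.nonNegative⁻¹ (fromℕ (suc k)) {{ℚ.normalize-nonNeg (suc k) 1}}) (*-recip≤1 (0≤card s)) ⟩
      fromℕ (suc k) * 1ℚ
        ≡⟨ ℚ.*-identityʳ (fromℕ (suc k)) ⟩
      fromℕ (suc k) ∎
      where
      open ℚ.≤-Reasoning
      links : ∑ s (λ u → 1ℚ + B u) ≤ card s * fromℕ (suc k)
      links = begin
        ∑ s (λ u → 1ℚ + B u)
          ≡⟨ ∑-+ s (λ _ → 1ℚ) B ⟩
        card s + ∑ s B
          ≡⟨ cong (card s +_) (begin-equality
               ∑ s B
                 ≡⟨ ∑-cong s (λ u _ → ∑-⊓ s (adj u) (λ v → recip (gap k (s ⊓ adj v) u))) ⟩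
               ∑ s (λ u → ∑ s λ v → adj u v ▸ recip (gap k (s ⊓ adj v) u))
                 ≡⟨ ∑-swap s s (λ u v → adj u v ▸ recip (gap k (s ⊓ adj v) u)) ⟩
               ∑ s (λ v → ∑ s λ u → adj u v ▸ recip (gap k (s ⊓ adj v) u))
                 ≡⟨ ∑-cong s (λ v _ → trans
                      (∑-cong s λ u _ → cong (_▸ recip (gap k (s ⊓ adj v) u)) (adj-sym u v))
                      (sym (∑-⊓ s (adj v) (λ u → recip (gap k (s ⊓ adj v) u))))) ⟩
               ∑ s (λ v → ∑ (s ⊓ adj v) λ u → recip (gap k (s ⊓ adj v) u)) ∎) ⟩
        card s + ∑ s (λ v → ∑ (s ⊓ adj v) λ u → recip (gap k (s ⊓ adj v) u))
          ≤⟨ ℚ.+-monoʳ-≤ (card s) (∑-mono s λ v sv → Bounds.gap-sum (ih v sv)) ⟩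
        card s + ∑ s (λ _ → fromℕ k)
          ≡⟨ cong (card s +_) (trans (∑-cong s λ _ _ → sym (ℚ.*-identityʳ (fromℕ k))) (∑-* s (fromℕ k) (λ _ → 1ℚ))) ⟩
        card s + fromℕ k * card s
          ≡⟨ solve 2 (λ m k → m :+ k :* m := m :* (con 1ℚ :+ k)) refl (card s) (fromℕ k) ⟩
        card s * (1ℚ + fromℕ k)
          ≡⟨ cong (card s *_) (fromℕ-suc k) ⟨
        card s * fromℕ (suc k) ∎

  -- Induction on the clique bound, which drops by one in each neighbourhood; at bound 0 the set is
  -- empty and all claims are trivial.
  bounds : ∀ k s → CliqueBound k s → Bounds k s
  bounds zero s cb = record
    { sep-pos = λ u _ su _ _ → ⊥-elim (cliqueBound-zero cb u su)
    ; sep≤1   = λ u _ su _ _ → ⊥-elim (cliqueBound-zero cb u su)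
    ; gap-pos = λ u su → ⊥-elim (cliqueBound-zero cb u su)
    ; gap-sum = ℚ.≤-reflexive (trans (∑-cong s λ u su → ⊥-elim (cliqueBound-zero cb u su)) (∑-zero s))
    }
  bounds (suc k) s cb = record
    { sep-pos = λ u w su sw uw → sep-pos su sw uw
    ; sep≤1   = λ u w su sw uw → sep≤1 su sw uw
    ; gap-pos = λ u su → gap-pos su
    ; gap-sum = gap-sum
    }
    where open Step k s (λ v sv → bounds k (s ⊓ adj v) (cliqueBound-suc cb v sv))

-- Sums over edges

-- Real sums are formed termwise on the approximating sequences, so they can be handled index by
-- index as rational sums.
seq-sumℝ : ∀ {n} (f : Fin n → ℝ) m → seq (sumℝ f) m ≡ sum λ i → seq (f i) m
seq-sumℝ {zero}  f m = refl
seq-sumℝ {suc n} f m = cong (seq (f zero) m +_) (seq-sumℝ (λ i → f (suc i)) m)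

module _ {n : ℕ} (G : Graph n) where
  open Greedy G
  open Graph G using (Adj; adj?)

  -- Rational counterpart of `edgeTerm`. The decision is an argument so that proofs can branch on
  -- it.
  term : (Edge G → ℚ) → ∀ u v → Dec (u Fin.< v × Adj u v) → ℚ
  term g u v (yes (u<v , u~v)) = g (edge u v u<v u~v)
  term g u v (no _)            = 0ℚ

  isEdge? : ∀ u v → Dec (u Fin.< v × Adj u v)
  isEdge? u v = (u Fin.<? v) ×-dec adj? u v

  ∑ᴱ : (Edge G → ℚ) → ℚ
  ∑ᴱ g = sum λ u → sum λ v → term g u v (isEdge? u v)

  seq-sumEdges : ∀ (f : Edge G → ℝ) m → seq (sumEdges G f) m ≡ ∑ᴱ λ e → seq (f e) m
  seq-sumEdges f m = trans (seq-sumℝ (λ u → sumℝ λ v → edgeTerm G f u v (isEdge? u v)) m) (sum-cong-≗ λ u →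
    trans (seq-sumℝ (λ v → edgeTerm G f u v (isEdge? u v)) m) (sum-cong-≗ λ v → go u v (isEdge? u v)))
    where
    go : ∀ u v d → seq (edgeTerm G f u v d) m ≡ term (λ e → seq (f e) m) u v d
    go u v (yes _) = refl
    go u v (no _)  = refl

  ∑ᴱ-cong : ∀ {f g} → (∀ e → f e ≡ g e) → ∑ᴱ f ≡ ∑ᴱ g
  ∑ᴱ-cong {f} {g} h = sum-cong-≗ λ u → sum-cong-≗ λ v → go u v (isEdge? u v)
    where
    go : ∀ u v d → term f u v d ≡ term g u v d
    go u v (yes _) = h _
    go u v (no _)  = refl

  ∑ᴱ-mono : ∀ {f g} → (∀ e → f e ≤ g e) → ∑ᴱ f ≤ ∑ᴱ g
  ∑ᴱ-mono {f} {g} h = sum-mono λ u → sum-mono λ v → go u v (isEdge? u v)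
    where
    go : ∀ u v d → term f u v d ≤ term g u v d
    go u v (yes _) = h _
    go u v (no _)  = ℚ.≤-refl

  ∑ᴱ-+ : ∀ f g → ∑ᴱ (λ e → f e + g e) ≡ ∑ᴱ f + ∑ᴱ g
  ∑ᴱ-+ f g = trans (sum-cong-≗ λ u → trans (sum-cong-≗ λ v → go u v (isEdge? u v))
    (∑-distrib-+ (λ v → term f u v (isEdge? u v)) (λ v → term g u v (isEdge? u v))))
    (∑-distrib-+ (λ u → sum λ v → term f u v (isEdge? u v)) (λ u → sum λ v → term g u v (isEdge? u v)))
    where
    go : ∀ u v d → term (λ e → f e + g e) u v d ≡ term f u v d + term g u v d
    go u v (yes _) = refl
    go u v (no _)  = refl

  ∑ᴱ-* : ∀ p f → ∑ᴱ (λ e → p * f e) ≡ p * ∑ᴱ f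
  ∑ᴱ-* p f = trans (sum-cong-≗ λ u → trans (sum-cong-≗ λ v → go u v (isEdge? u v))
    (sym (*-distribˡ-sum p (λ v → term f u v (isEdge? u v)))))
    (sym (*-distribˡ-sum p (λ u → sum λ v → term f u v (isEdge? u v))))
    where
    go : ∀ u v d → term (λ e → p * f e) u v d ≡ p * term f u v d
    go u v (yes _) = refl
    go u v (no _)  = sym (ℚ.*-zeroʳ p)

  ∑ᴱ-zero : ∑ᴱ (λ _ → 0ℚ) ≡ 0ℚ
  ∑ᴱ-zero = trans (∑ᴱ-cong λ _ → sym (ℚ.*-zeroˡ 0ℚ)) (trans (∑ᴱ-* 0ℚ (λ _ → 0ℚ)) (ℚ.*-zeroˡ (∑ᴱ λ _ → 0ℚ)))

  full : VSet n
  full _ = true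

  -- An edge is stored with increasing endpoints. By the symmetry of F the second copy can be read
  -- with endpoints reversed, so each ordered adjacent pair occurs once; the diagonal vanishes by
  -- irreflexivity.
  ∑ᴱ-double : ∀ (F : Fin n → Fin n → ℚ) → (∀ u v → F u v ≡ F v u) →
    ∑ᴱ (λ e → F (src e) (tgt e)) + ∑ᴱ (λ e → F (src e) (tgt e)) ≡ ∑ full λ u → ∑ (full ⊓ adj u) (F u)
  ∑ᴱ-double F F-sym = begin
    ∑ᴱ (λ e → F (src e) (tgt e)) + ∑ᴱ (λ e → F (src e) (tgt e))
      ≡⟨ cong₂ _+_ ordered (trans ordered (∑-comm H)) ⟩
    sum (λ u → sum λ v → H u v) + sum (λ u → sum λ v → H v u)
      ≡⟨ ∑-distrib-+ (λ u → sum λ v → H u v) (λ u → sum λ v → H v u) ⟨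
    sum (λ u → sum (λ v → H u v) + sum (λ v → H v u))
      ≡⟨ (sum-cong-≗ λ u → trans (sym (∑-distrib-+ (λ v → H u v) (λ v → H v u))) (sum-cong-≗ λ v → both u v)) ⟩
    ∑ full (λ u → ∑ (full ⊓ adj u) (F u)) ∎
    where
    open ≡-Reasoning
    H : Fin n → Fin n → ℚ
    H u v = (does (u Fin.<? v) ∧ adj u v) ▸ F u v
    ordered : ∑ᴱ (λ e → F (src e) (tgt e)) ≡ sum λ u → sum λ v → H u v
    ordered = sum-cong-≗ λ u → sum-cong-≗ λ v → go u v (isEdge? u v)
      where
      go : ∀ u v d → term (λ e → F (src e) (tgt e)) u v d ≡ does d ▸ F u v
      go u v (yes _) = refl
      go u v (no _)  = refl
    both : ∀ u v → H u v + H v u ≡ adj u v ▸ F u v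
    both u v with Fin.<-cmp u v
    ... | tri< u<v _ v≮u rewrite dec-true (u Fin.<? v) u<v | dec-false (v Fin.<? u) v≮u = ℚ.+-identityʳ _
    ... | tri> u≮v _ v<u rewrite dec-false (u Fin.<? v) u≮v | dec-true (v Fin.<? u) v<u
                               | adj-sym v u | F-sym v u = ℚ.+-identityˡ _
    ... | tri≈ _ refl _ rewrite adj-irrefl u | Bool.∧-zeroʳ (does (u Fin.<? u)) = refl

  -- Cauchy-Schwarz over edges and the sum of reciprocal probabilities

  -- Sum the tangent bounds ps² ≥ 2ts - t²/p with t = γS. The result 2γS² - γ²S²R is at least γS²
  -- because γR ≤ 1.
  edge-Cauchy-Schwarz : ∀ γ (p s : Edge G → ℚ) → 0ℚ ≤ γ → (∀ e → 0ℚ < p e) →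
    γ * ∑ᴱ (λ e → recip (p e)) ≤ 1ℚ → γ * (∑ᴱ s * ∑ᴱ s) ≤ ∑ᴱ λ e → p e * (s e * s e)
  edge-Cauchy-Schwarz γ p s 0≤γ 0<p γR≤1 = begin
    γ * (S * S)
      ≤⟨ ≤-by _ (0≤* (0≤* 0≤γ (0≤square S)) (p≤q⇒0≤q-p γR≤1))
           (solve 3 (λ g S R → (g :* S :+ g :* S) :* S :+ (:- (g :* S :* (g :* S))) :* R :- g :* (S :* S)
             := g :* (S :* S) :* (con 1ℚ :- g :* R)) refl γ S R) ⟩
    (t + t) * S + - (t * t) * R
      ≡⟨ cong₂ _+_ (∑ᴱ-* (t + t) s) (∑ᴱ-* (- (t * t)) (λ e → recip (p e))) ⟨
    ∑ᴱ (λ e → (t + t) * s e) + ∑ᴱ (λ e → - (t * t) * recip (p e))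
      ≡⟨ ∑ᴱ-+ _ _ ⟨
    ∑ᴱ (λ e → (t + t) * s e + - (t * t) * recip (p e))
      ≤⟨ ∑ᴱ-mono tangent ⟩
    ∑ᴱ (λ e → p e * (s e * s e)) ∎
    where
    open ℚ.≤-Reasoning
    S = ∑ᴱ s
    R = ∑ᴱ λ e → recip (p e)
    t = γ * S
    tangent : ∀ e → (t + t) * s e + - (t * t) * recip (p e) ≤ p e * (s e * s e)
    tangent e = *-cancelˡ (0<p e) (≤-by _ (0≤square (p e * s e - t)) (begin-equality
      p e * (p e * (s e * s e)) - p e * ((t + t) * s e + - (t * t) * recip (p e))
        ≡⟨ solve 4 (λ p s t r → p :* (p :* (s :* s)) :- p :* ((t :+ t) :* s :+ (:- (t :* t)) :* r)
             := p :* s :* (p :* s) :- (t :+ t) :* (p :* s) :+ t :* t :* (p :* r)) refl (p e) (s e) t (recip (p e)) ⟩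
      p e * s e * (p e * s e) - (t + t) * (p e * s e) + t * t * (p e * recip (p e))
        ≡⟨ cong (λ z → p e * s e * (p e * s e) - (t + t) * (p e * s e) + t * t * z) (*-recip (0<p e)) ⟩
      p e * s e * (p e * s e) - (t + t) * (p e * s e) + t * t * 1ℚ
        ≡⟨ solve 2 (λ y t → y :* y :- (t :+ t) :* y :+ t :* t :* con 1ℚ := (y :- t) :* (y :- t)) refl (p e * s e) t ⟩
      (p e * s e - t) * (p e * s e - t) ∎))

  -- c ≥ 2r - r²/c, summed over the vertices with r = n/k
  gap-total : ∀ k ι → Bounds k full → fromℕ k * ι ≡ 1ℚ →
    card full * card full * ι ≤ ∑ full (gap k full)
  gap-total k ι bd kι≡1 = begin
    M * M * ι
      ≡⟨ ℚ.*-identityʳ (M * M * ι) ⟨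
    M * M * ι * 1ℚ
      ≡⟨ solve 2 (λ x y → x :* y := (x :+ x) :* y :+ (:- x) :* y) refl (M * M * ι) 1ℚ ⟩
    (M * M * ι + M * M * ι) * 1ℚ + - (M * M * ι) * 1ℚ
      ≡⟨ cong (λ z → (M * M * ι + M * M * ι) * 1ℚ + - (M * M * ι) * z) kι≡1 ⟨
    (M * M * ι + M * M * ι) * 1ℚ + - (M * M * ι) * (fromℕ k * ι)
      ≡⟨ solve 3 (λ m i k → (m :* m :* i :+ m :* m :* i) :* con 1ℚ :+ (:- (m :* m :* i)) :* (k :* i)
           := (m :* i :+ m :* i) :* m :+ (:- (m :* i :* (m :* i) :* k))) refl M ι (fromℕ k) ⟩
    (r + r) * M + - (r * r * fromℕ k)
      ≤⟨ ℚ.+-monoʳ-≤ ((r + r) * M) (ℚ.neg-antimono-≤ (*-monoˡ (0≤square r) (Bounds.gap-sum bd))) ⟩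
    (r + r) * M + - (r * r * ∑ full (λ u → recip (gap k full u)))
      ≡⟨ cong₂ _-_ (∑-* full (r + r) (λ _ → 1ℚ)) (∑-* full (r * r) (λ u → recip (gap k full u))) ⟨
    ∑ full (λ _ → (r + r) * 1ℚ) - ∑ full (λ u → r * r * recip (gap k full u))
      ≡⟨ ∑-minus full _ _ ⟨
    ∑ full (λ u → (r + r) * 1ℚ - r * r * recip (gap k full u))
      ≤⟨ ∑-mono full (λ u _ → tangent (Bounds.gap-pos bd u refl)) ⟩
    ∑ full (gap k full) ∎
    where
    open ℚ.≤-Reasoning
    M = card full
    r = M * ι
    tangent : ∀ {c} → 0ℚ < c → (r + r) * 1ℚ - r * r * recip c ≤ c
    tangent {c} 0<c = *-cancelˡ 0<c (≤-by _ (0≤square (c - r)) (begin-equality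
      c * c - c * ((r + r) * 1ℚ - r * r * recip c)
        ≡⟨ solve 3 (λ c r i → c :* c :- c :* ((r :+ r) :* con 1ℚ :- r :* r :* i)
             := c :* c :- (r :+ r) :* c :+ r :* r :* (c :* i)) refl c r (recip c) ⟩
      c * c - (r + r) * c + r * r * (c * recip c)
        ≡⟨ cong (λ z → c * c - (r + r) * c + r * r * z) (*-recip 0<c) ⟩
      c * c - (r + r) * c + r * r * 1ℚ
        ≡⟨ solve 2 (λ c r → c :* c :- (r :+ r) :* c :+ r :* r :* con 1ℚ := (c :- r) :* (c :- r)) refl c r ⟩
      (c - r) * (c - r) ∎))

  -- Doubling the edge sum gives the sum over ordered pairs, which is n² minus the total of the
  -- gaps; `gap-total` bounds that total below by n²/k.
  recip-sep-total : ∀ k ι → Bounds k full → fromℕ k * ι ≡ 1ℚ →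
    let R = ∑ᴱ λ e → recip (sepProb k full (src e) (tgt e)) in
    R + R ≤ (1ℚ - ι) * (card full * card full)
  recip-sep-total k ι bd kι≡1 = begin
    R + R
      ≡⟨ ∑ᴱ-double (λ u w → recip (sepProb k full u w)) (λ u w → cong recip (sepProb-sym k full u w)) ⟩
    S
      ≡⟨ solve 2 (λ s m → s := m :- (m :- s)) refl S (card full * card full) ⟩
    card full * card full - (card full * card full - S)
      ≡⟨ cong (λ z → card full * card full - z) gaps ⟨
    card full * card full - ∑ full (gap k full)
      ≤⟨ ℚ.+-monoʳ-≤ (card full * card full) (ℚ.neg-antimono-≤ (gap-total k ι bd kι≡1)) ⟩
    card full * card full - card full * card full * ι
      ≡⟨ solve 2 (λ m i → m :- m :* i := (con 1ℚ :- i) :* m) refl (card full * card full) ι ⟩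
    (1ℚ - ι) * (card full * card full) ∎
    where
    open ℚ.≤-Reasoning
    R = ∑ᴱ λ e → recip (sepProb k full (src e) (tgt e))
    S = ∑ full λ u → ∑ (full ⊓ adj u) λ w → recip (sepProb k full u w)
    gaps : ∑ full (gap k full) ≡ card full * card full - S
    gaps = trans (∑-minus full (λ _ → card full) (λ u → ∑ (full ⊓ adj u) λ w → recip (sepProb k full u w)))
      (cong (_- S) (trans (∑-cong full λ _ _ → sym (ℚ.*-identityʳ (card full))) (∑-* full (card full) (λ _ → 1ℚ))))


  -- Chains of picks and their partitions

  -- The vertices successively picked in a greedy partition of s.
  data Chain : ℕ → VSet n → Set where
    done : ∀ {k s} → (∀ v → s v ≡ true → ⊥) → Chain k s
    step : ∀ {k s} v → s v ≡ true → Chain k (s ⊓ adj v) → Chain (suc k) s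

  -- The 0/1 indicator of separation, written with the same `split` as `sepProb` so that its
  -- expectation obeys the same recursion.
  separates : ∀ {k s} → Chain k s → Fin n → Fin n → ℚ
  separates (done _)     u w = 0ℚ
  separates (step v _ c) u w = split (adj v u) (adj v w) (separates c u w)

  part : VSet n → Fin n → Subset n
  part s v = Vec.tabulate λ x → s x ∧ not (adj v x)

  ∈part⁺ : ∀ {s v x} → s x ≡ true → adj v x ≡ false → x ∈ part s v
  ∈part⁺ {s} {v} {x} sx vx = Vec.lookup⇒[]= x (part s v)
    (trans (Vec.lookup∘tabulate _ x) (∧-intro sx (cong not vx)))

  ∈part⁻ : ∀ {s v x} → x ∈ part s v → s x ≡ true × adj v x ≡ false
  ∈part⁻ {s} {v} {x} x∈ = ∧-left e , Bool.not-injective (∧-right {s x} e)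
    where
    e : s x ∧ not (adj v x) ≡ true
    e = trans (sym (Vec.lookup∘tabulate _ x)) (Vec.[]=⇒lookup x∈)

  parts : ∀ {k s} → Chain k s → List (Subset n)
  parts (done _)             = []
  parts (step {s = s} v _ c) = part s v ∷ parts c

  parts-length : ∀ {k s} (c : Chain k s) → length (parts c) ℕ.≤ k
  parts-length (done _)     = ℕ.z≤n
  parts-length (step _ _ c) = ℕ.s≤s (parts-length c)

  parts-inside : ∀ {k s} (c : Chain k s) → All (λ T → ∀ x → x ∈ T → s x ≡ true) (parts c)
  parts-inside (done _)     = []
  parts-inside (step v _ c) = (λ x x∈ → proj₁ (∈part⁻ x∈)) ∷ All.map (λ h x x∈ → ∧-left (h x x∈)) (parts-inside c)

  parts-nonempty : ∀ {k s} (c : Chain k s) → All Nonempty (parts c)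
  parts-nonempty (done _)      = []
  parts-nonempty (step v sv c) = (v , ∈part⁺ sv (adj-irrefl v)) ∷ parts-nonempty c

  -- All later parts lie inside N(v) by `parts-inside`, whereas the part of v avoids N(v).
  parts-disjoint : ∀ {k s} (c : Chain k s) → AllPairs (λ S T → Empty (S ∩ T)) (parts c)
  parts-disjoint (done _)             = []
  parts-disjoint (step {s = s} v _ c) = All.map apart (parts-inside c) ∷ parts-disjoint c
    where
    apart : ∀ {T} → (∀ x → x ∈ T → (s ⊓ adj v) x ≡ true) → Empty (part s v ∩ T)
    apart {T} inside (x , x∈) with x∈p∩q⁻ (part s v) T x∈
    ... | x∈S , x∈T with trans (sym (proj₂ (∈part⁻ x∈S))) (∧-right {s x} (inside x x∈T))
    ...   | ()

  parts-cover : ∀ {k s} (c : Chain k s) x → s x ≡ true → Any (x ∈_) (parts c)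
  -- The Boolean `adj v x` is passed along with its equation, so that `separates-parts` can branch
  -- on it and have `index` compute.
  parts-cover-step : ∀ {k s} v (c : Chain k (s ⊓ adj v)) x → s x ≡ true →
    ∀ α → adj v x ≡ α → Any (x ∈_) (part s v ∷ parts c)
  parts-cover (done none)  x sx = ⊥-elim (none x sx)
  parts-cover (step v _ c) x sx = parts-cover-step v c x sx (adj v x) refl
  parts-cover-step v c x sx true  vx = there (parts-cover c x (∧-intro sx vx))
  parts-cover-step v c x sx false vx = here (∈part⁺ sx vx)

  -- A vertex not adjacent to the pick v gets index 0, and any other gets a successor. Thus two
  -- vertices are separated at the first pick adjacent to exactly one of them, and united at a pick
  -- adjacent to neither.
  separates-parts : ∀ {k s} (c : Chain k s) u w su sw →
    (separates c u w ≡ 1ℚ × index (parts-cover c u su) ≢ index (parts-cover c w sw)) ⊎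
    (separates c u w ≡ 0ℚ × index (parts-cover c u su) ≡ index (parts-cover c w sw))
  separates-parts (done none) u w su sw = ⊥-elim (none u su)
  separates-parts {s = s} (step v _ c) u w su sw = go (adj v u) refl (adj v w) refl
    where
    go : ∀ α vu β vw → let i = index (parts-cover-step {s = s} v c u su α vu)
                           j = index (parts-cover-step {s = s} v c w sw β vw) in
      (split α β (separates c u w) ≡ 1ℚ × i ≢ j) ⊎ (split α β (separates c u w) ≡ 0ℚ × i ≡ j)
    go true  vu false vw = inj₁ (refl , λ ())
    go false vu true  vw = inj₁ (refl , λ ())
    go false vu false vw = inj₂ (refl , refl)
    go true  vu true  vw with separates-parts c u w (∧-intro su vu) (∧-intro sw vw)
    ... | inj₁ (e , i≢j) = inj₁ (e , λ eq → i≢j (Fin.suc-injective eq))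
    ... | inj₂ (e , i≡j) = inj₂ (e , cong suc i≡j)

  partition : ∀ {k} → Chain k full → PartitionAtMost n k
  partition c = record
    { parts = parts c ; nonempty = parts-nonempty c ; disjoint = parts-disjoint c
    ; covers = λ x → parts-cover c x refl } , parts-length c

  seq-separatedMass : ∀ {k} (c : Chain k full) a m →
    seq (separatedMass G (proj₁ (partition c)) a) m ≡ ∑ᴱ λ e → separates c (src e) (tgt e) * seq (a e) m
  seq-separatedMass c a m = trans (seq-sumEdges _ m) (∑ᴱ-cong λ e →
    go (index (parts-cover c (src e) refl) Fin.≟ index (parts-cover c (tgt e) refl)) (separates-parts c (src e) (tgt e) refl refl))
    where
    go : ∀ {p q σ x} (d : Dec (p ≡ q)) → (σ ≡ 1ℚ × p ≢ q) ⊎ (σ ≡ 0ℚ × p ≡ q) → seq (unless d x) m ≡ σ * seq x m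
    go {x = x} (yes _)  (inj₂ (refl , _)) = sym (ℚ.*-zeroˡ (seq x m))
    go {x = x} (no _)   (inj₁ (refl , _)) = sym (ℚ.*-identityˡ (seq x m))
    go         (yes eq) (inj₁ (_ , ≢))    = ⊥-elim (≢ eq)
    go         (no ≢)   (inj₂ (_ , eq))   = ⊥-elim (≢ eq)

-- Finitely supported distributions with rational weights

module _ {A : Set} where

  -- The weights need not add up to 1, so branches of the process can be scaled and concatenated
  -- freely.
  𝔼 : List (ℚ × A) → (A → ℚ) → ℚ
  𝔼 []             X = 0ℚ
  𝔼 ((q , a) ∷ xs) X = q * X a + 𝔼 xs X

  𝔼-++ : ∀ xs ys X → 𝔼 (xs ++ ys) X ≡ 𝔼 xs X + 𝔼 ys X
  𝔼-++ []             ys X = sym (ℚ.+-identityˡ (𝔼 ys X))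
  𝔼-++ ((q , a) ∷ xs) ys X = trans (cong (q * X a +_) (𝔼-++ xs ys X)) (sym (ℚ.+-assoc (q * X a) (𝔼 xs X) (𝔼 ys X)))

  𝔼-concat : ∀ {m} (f : Fin m → List (ℚ × A)) X → 𝔼 (concat (tabulate f)) X ≡ sum λ i → 𝔼 (f i) X
  𝔼-concat {zero}  f X = refl
  𝔼-concat {suc m} f X = trans (𝔼-++ (f zero) (concat (tabulate λ i → f (suc i))) X)
    (cong (𝔼 (f zero) X +_) (𝔼-concat (λ i → f (suc i)) X))

  𝔼-cong : ∀ xs {X Y} → (∀ a → X a ≡ Y a) → 𝔼 xs X ≡ 𝔼 xs Y
  𝔼-cong []             h = refl
  𝔼-cong ((q , a) ∷ xs) h = cong₂ _+_ (cong (q *_) (h a)) (𝔼-cong xs h)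

  𝔼-*ʳ : ∀ xs X p → 𝔼 xs (λ a → X a * p) ≡ 𝔼 xs X * p
  𝔼-*ʳ []             X p = sym (ℚ.*-zeroˡ p)
  𝔼-*ʳ ((q , a) ∷ xs) X p = trans (cong (q * (X a * p) +_) (𝔼-*ʳ xs X p))
    (solve 4 (λ q x p e → q :* (x :* p) :+ e :* p := (q :* x :+ e) :* p) refl q (X a) p (𝔼 xs X))

  𝔼-zero : ∀ xs → 𝔼 xs (λ _ → 0ℚ) ≡ 0ℚ
  𝔼-zero []             = refl
  𝔼-zero ((q , a) ∷ xs) = cong₂ _+_ (ℚ.*-zeroʳ q) (𝔼-zero xs)

  -- Total weight 1 enters in the mixed cases, where `split` is the constant 1.
  𝔼-split : ∀ xs α β X → 𝔼 xs (λ _ → 1ℚ) ≡ 1ℚ → 𝔼 xs (λ a → split α β (X a)) ≡ split α β (𝔼 xs X)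
  𝔼-split xs true  true  X e = refl
  𝔼-split xs true  false X e = e
  𝔼-split xs false true  X e = e
  𝔼-split xs false false X e = 𝔼-zero xs

  𝔼-∑ᴱ : ∀ {n} (G : Graph n) xs (X : A → Edge G → ℚ) → 𝔼 xs (λ a → ∑ᴱ G (X a)) ≡ ∑ᴱ G λ e → 𝔼 xs λ a → X a e
  𝔼-∑ᴱ G []             X = sym (∑ᴱ-zero G)
  𝔼-∑ᴱ G ((q , a) ∷ xs) X = trans (cong₂ _+_ (sym (∑ᴱ-* G q (X a))) (𝔼-∑ᴱ G xs X))
    (sym (∑ᴱ-+ G (λ e → q * X a e) (λ e → 𝔼 xs λ a → X a e)))

  distribution : ∀ xs → All (λ x → 0ℚ ≤ proj₁ x) xs → 𝔼 xs (λ _ → 1ℚ) ≡ 1ℚ → Distribution A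
  distribution xs nonNeg total = record
    { size    = length xs
    ; outcome = λ i → proj₂ (lookup xs i)
    ; prob    = λ i → fromℚ (proj₁ (lookup xs i))
    ; nonNeg  = λ i → mk≤ℝ λ ε 0<ε → 0 , λ _ _ → 0≤+ (All.lookup nonNeg (∈-lookup i)) (ℚ.<⇒≤ 0<ε)
    ; total   = (mk≤ℝ λ ε 0<ε → 0 , λ m _ → ≤+ε 0<ε (total′ m)) , (mk≤ℝ λ ε 0<ε → 0 , λ m _ → ≤+ε 0<ε (sym (total′ m)))
    }
    where
    ≤+ε : ∀ {p q ε} → 0ℚ < ε → p ≡ q → p ≤ q + ε
    ≤+ε {p} {q} {ε} 0<ε refl = subst (_≤ p + ε) (ℚ.+-identityʳ p) (ℚ.+-monoʳ-≤ p (ℚ.<⇒≤ 0<ε))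
    weights : ∀ ys m → seq (sumℝ λ i → fromℚ (proj₁ (lookup ys i))) m ≡ 𝔼 ys (λ _ → 1ℚ)
    weights []             m = refl
    weights ((q , a) ∷ ys) m = cong₂ _+_ (sym (ℚ.*-identityʳ q)) (weights ys m)
    total′ : ∀ m → seq (sumℝ λ i → fromℚ (proj₁ (lookup xs i))) m ≡ 1ℚ
    total′ m = trans (weights xs m) total

  seq-expectation : ∀ xs h₁ h₂ (X : A → ℝ) m →
    seq (expectation (distribution xs h₁ h₂) X) m ≡ 𝔼 xs λ a → seq (X a) m
  seq-expectation xs _ _ X m = go xs
    where
    go : ∀ ys → seq (sumℝ λ i → fromℚ (proj₁ (lookup ys i)) *ℝ X (proj₂ (lookup ys i))) m ≡ 𝔼 ys λ a → seq (X a) m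
    go []             = refl
    go ((q , a) ∷ ys) = cong (q * seq (X a) m +_) (go ys)

𝔼-map : ∀ {A B : Set} r (f : A → B) xs X → 𝔼 (map (λ x → r * proj₁ x , f (proj₂ x)) xs) X ≡ r * 𝔼 xs λ a → X (f a)
𝔼-map r f []             X = sym (ℚ.*-zeroʳ r)
𝔼-map r f ((q , a) ∷ xs) X = trans (cong (r * q * X (f a) +_) (𝔼-map r f xs X))
  (solve 4 (λ r q x e → r :* q :* x :+ r :* e := r :* (q :* x :+ e)) refl r q (X (f a)) (𝔼 xs λ a → X (f a)))

-- The distribution of the greedy process

module _ {n : ℕ} (G : Graph n) where
  open Greedy G

  nonempty? : ∀ (s : VSet n) → Dec (∃ λ v → s v ≡ true)
  nonempty? s = Fin.any? λ v → s v Bool.≟ true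

  -- An exhausted set yields one outcome of weight 1, which keeps the total weight at 1. `branch`
  -- receives `s v` with its equation because `step` stores a proof of membership.
  greedy : ∀ k s → CliqueBound k s → List (ℚ × Chain G k s)
  branch : ∀ k s → CliqueBound (suc k) s → ∀ v α → s v ≡ α → List (ℚ × Chain G (suc k) s)
  greedy-step : ∀ k s → CliqueBound (suc k) s → Dec (∃ λ v → s v ≡ true) → List (ℚ × Chain G (suc k) s)
  greedy zero    s cb = (1ℚ , done (cliqueBound-zero cb)) ∷ []
  greedy (suc k) s cb = greedy-step k s cb (nonempty? s)
  greedy-step k s cb (no none) = (1ℚ , done (λ v sv → none (v , sv))) ∷ []
  greedy-step k s cb (yes _)   = concat (tabulate λ v → branch k s cb v (s v) refl)
  branch k s cb v true  sv = map (λ x → recip (card s) * proj₁ x , step v sv (proj₂ x))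
    (greedy k (s ⊓ adj v) (cliqueBound-suc cb v sv))
  branch k s cb v false sv = []

  greedy-nonNeg : ∀ k s cb → All (λ x → 0ℚ ≤ proj₁ x) (greedy k s cb)
  greedy-nonNeg zero    s cb = 0≤1 ∷ []
  greedy-nonNeg (suc k) s cb with nonempty? s
  ... | no _  = 0≤1 ∷ []
  ... | yes _ = All.concat⁺ (All.tabulate⁺ λ v → go v (s v) refl)
    where
    go : ∀ v α e → All (λ x → 0ℚ ≤ proj₁ x) (branch k s cb v α e)
    go v true  e = All.map⁺ (All.map (0≤* (0≤recip (0≤card s))) (greedy-nonNeg k (s ⊓ adj v) (cliqueBound-suc cb v e)))
    go v false e = []

  -- The law of total expectation: Y v is the expectation of X conditional on v being picked first.
  𝔼-greedy : ∀ k s cb {v} → s v ≡ true → ∀ (X : Chain G (suc k) s → ℚ) (Y : Fin n → ℚ) →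
    (∀ v sv → 𝔼 (greedy k (s ⊓ adj v) (cliqueBound-suc cb v sv)) (λ c → X (step v sv c)) ≡ Y v) →
    𝔼 (greedy (suc k) s cb) X ≡ recip (card s) * ∑ s Y
  𝔼-greedy k s cb {v} sv X Y h with nonempty? s
  ... | no none = ⊥-elim (none (v , sv))
  ... | yes _   = trans (𝔼-concat (λ v → branch k s cb v (s v) refl) X)
    (trans (sum-cong-≗ λ v → go v (s v) refl) (sym (*-distribˡ-sum (recip (card s)) (λ v → s v ▸ Y v))))
    where
    go : ∀ v α e → 𝔼 (branch k s cb v α e) X ≡ recip (card s) * (α ▸ Y v)
    go v true  e = trans (𝔼-map (recip (card s)) (step v e) (greedy k (s ⊓ adj v) (cliqueBound-suc cb v e)) X)
      (cong (recip (card s) *_) (h v e))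
    go v false e = sym (ℚ.*-zeroʳ (recip (card s)))

  -- The proof stored in `done` comes from the one returned by `nonempty?`, not from the given one;
  -- hence the existential.
  greedy-empty : ∀ k s cb → ¬ (∃ λ v → s v ≡ true) → ∃ λ h → greedy (suc k) s cb ≡ (1ℚ , done h) ∷ []
  greedy-empty k s cb none with nonempty? s
  ... | no none′ = (λ v sv → none′ (v , sv)) , refl
  ... | yes some = ⊥-elim (none some)

  greedy-total : ∀ k s cb → 𝔼 (greedy k s cb) (λ _ → 1ℚ) ≡ 1ℚ
  greedy-total zero    s cb = refl
  greedy-total (suc k) s cb = go (nonempty? s)
    where
    go : Dec (∃ λ v → s v ≡ true) → 𝔼 (greedy (suc k) s cb) (λ _ → 1ℚ) ≡ 1ℚ
    go (no none)      rewrite proj₂ (greedy-empty k s cb none) = refl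
    go (yes (v , sv)) = trans (𝔼-greedy k s cb sv (λ _ → 1ℚ) (λ _ → 1ℚ) λ v sv →
      greedy-total k (s ⊓ adj v) (cliqueBound-suc cb v sv))
      (trans (ℚ.*-comm (recip (card s)) (card s)) (*-recip (card-pos s v sv)))

  -- Both sides satisfy the same recursion on the first pick, by `𝔼-split`; on an empty set both are
  -- 0.
  greedy-separates : ∀ k s cb u w → 𝔼 (greedy k s cb) (λ c → separates G c u w) ≡ sepProb k s u w
  greedy-separates zero    s cb u w = refl
  greedy-separates (suc k) s cb u w = go (nonempty? s)
    where
    go : Dec (∃ λ v → s v ≡ true) → 𝔼 (greedy (suc k) s cb) (λ c → separates G c u w) ≡ sepProb (suc k) s u w
    go (yes (v , sv)) = 𝔼-greedy k s cb sv (λ c → separates G c u w)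
      (λ v → split (adj v u) (adj v w) (sepProb k (s ⊓ adj v) u w)) λ v sv →
      let xs = greedy k (s ⊓ adj v) (cliqueBound-suc cb v sv) in
      trans (𝔼-split xs (adj v u) (adj v w) (λ c → separates G c u w) (greedy-total k (s ⊓ adj v) (cliqueBound-suc cb v sv)))
        (cong (split (adj v u) (adj v w)) (greedy-separates k (s ⊓ adj v) (cliqueBound-suc cb v sv) u w))
    go (no none) rewrite proj₂ (greedy-empty k s cb none) = sym (trans (cong (recip (card s) *_)
      (trans (∑-cong s {g = λ _ → 0ℚ} λ v sv → ⊥-elim (none (v , sv))) (∑-zero s))) (ℚ.*-zeroʳ (recip (card s))))

-- Inequalities between reals

≤ℝ-trans : ∀ {x y z} → x ≤ℝ y → y ≤ℝ z → x ≤ℝ z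
≤ℝ-trans {x} {y} {z} (mk≤ℝ h) (mk≤ℝ k) = mk≤ℝ λ ε 0<ε →
  let N₁ , b₁ = h (½ * ε) (0<* (ℚ.positive⁻¹ ½) 0<ε)
      N₂ , b₂ = k (½ * ε) (0<* (ℚ.positive⁻¹ ½) 0<ε)
  in N₁ ℕ.⊔ N₂ , λ m N≤m → ℚ.≤-trans (b₁ m (ℕ.m⊔n≤o⇒m≤o N₁ N₂ N≤m)) (ℚ.≤-trans
    (ℚ.+-monoˡ-≤ (½ * ε) (b₂ m (ℕ.m⊔n≤o⇒n≤o N₁ N₂ N≤m)))
    (ℚ.≤-reflexive (solve 2 (λ z e → z :+ con ½ :* e :+ con ½ :* e := z :+ e) refl (seq z m) ε)))

≤-seq⇒≤ℝ : ∀ {x y} → (∀ m → seq x m ≤ seq y m) → x ≤ℝ y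
≤-seq⇒≤ℝ {x} {y} h = mk≤ℝ λ ε 0<ε → 0 , λ m _ → ℚ.≤-trans (h m)
  (subst (_≤ seq y m + ε) (ℚ.+-identityʳ (seq y m)) (ℚ.+-monoʳ-≤ (seq y m) (ℚ.<⇒≤ 0<ε)))

+ℝ-mono : ∀ {x y z w} → x ≤ℝ y → z ≤ℝ w → x +ℝ z ≤ℝ y +ℝ w
+ℝ-mono {x} {y} {z} {w} (mk≤ℝ h) (mk≤ℝ k) = mk≤ℝ λ ε 0<ε →
  let N₁ , b₁ = h (½ * ε) (0<* (ℚ.positive⁻¹ ½) 0<ε)
      N₂ , b₂ = k (½ * ε) (0<* (ℚ.positive⁻¹ ½) 0<ε)
  in N₁ ℕ.⊔ N₂ , λ m N≤m → ℚ.≤-trans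
    (ℚ.+-mono-≤ (b₁ m (ℕ.m⊔n≤o⇒m≤o N₁ N₂ N≤m)) (b₂ m (ℕ.m⊔n≤o⇒n≤o N₁ N₂ N≤m)))
    (ℚ.≤-reflexive (solve 3 (λ y w e → (y :+ con ½ :* e) :+ (w :+ con ½ :* e) := y :+ w :+ e) refl (seq y m) (seq w m) ε))

sumℝ-mono : ∀ {n} {f g : Fin n → ℝ} → (∀ i → f i ≤ℝ g i) → sumℝ f ≤ℝ sumℝ g
sumℝ-mono {zero}  h = ≤-seq⇒≤ℝ λ _ → ℚ.≤-refl
sumℝ-mono {suc n} h = +ℝ-mono (h zero) (sumℝ-mono λ i → h (suc i))

sumEdges-mono : ∀ {n} (G : Graph n) {f g : Edge G → ℝ} → (∀ e → f e ≤ℝ g e) → sumEdges G f ≤ℝ sumEdges G g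
sumEdges-mono G {f} {g} h = sumℝ-mono λ u → sumℝ-mono λ v → go u v (isEdge? G u v)
  where
  go : ∀ u v d → edgeTerm G f u v d ≤ℝ edgeTerm G g u v d
  go u v (yes _) = h _
  go u v (no _)  = ≤-seq⇒≤ℝ λ _ → ℚ.≤-refl

-- As p ≤ 1, the error ε does not grow under scaling, so the index for x and y also serves for the
-- products.
fromℚ-*-mono : ∀ {p x y} → 0ℚ ≤ p → p ≤ 1ℚ → x ≤ℝ y → fromℚ p *ℝ x ≤ℝ fromℚ p *ℝ y
fromℚ-*-mono {p} {x} {y} 0≤p p≤1 (mk≤ℝ h) = mk≤ℝ λ ε 0<ε → let N , b = h ε 0<ε in N , λ m N≤m → begin
  p * seq x m          ≤⟨ *-monoˡ 0≤p (b m N≤m) ⟩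
  p * (seq y m + ε)    ≡⟨ ℚ.*-distribˡ-+ p (seq y m) ε ⟩
  p * seq y m + p * ε  ≤⟨ ℚ.+-monoʳ-≤ (p * seq y m) (≤-by _ (0≤* (p≤q⇒0≤q-p p≤1) (ℚ.<⇒≤ 0<ε))
                            (solve 2 (λ p e → e :- p :* e := (con 1ℚ :- p) :* e) refl p ε)) ⟩
  p * seq y m + ε      ∎
  where open ℚ.≤-Reasoning

-- The coefficient of the lower bound

fromℕ-+ : ∀ m n → fromℕ (m ℕ.+ n) ≡ fromℕ m + fromℕ n
fromℕ-+ zero    n = sym (ℚ.+-identityˡ (fromℕ n))
fromℕ-+ (suc m) n = trans (fromℕ-suc (m ℕ.+ n)) (trans (cong (1ℚ +_) (fromℕ-+ m n))
  (trans (sym (ℚ.+-assoc 1ℚ (fromℕ m) (fromℕ n))) (cong (_+ fromℕ n) (sym (fromℕ-suc m)))))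

fromℕ-* : ∀ m n → fromℕ (m ℕ.* n) ≡ fromℕ m * fromℕ n
fromℕ-* zero    n = sym (ℚ.*-zeroˡ (fromℕ n))
fromℕ-* (suc m) n = trans (fromℕ-+ n (m ℕ.* n)) (trans (cong (fromℕ n +_) (fromℕ-* m n))
  (trans (solve 2 (λ m n → n :+ m :* n := (con 1ℚ :+ m) :* n) refl (fromℕ m) (fromℕ n)) (cong (_* fromℕ n) (sym (fromℕ-suc m)))))

fromℕ-inverse : ∀ k .{{_ : ℕ.NonZero k}} → fromℕ k * (ℤ.+ 1 ℚ./ k) ≡ 1ℚ
fromℕ-inverse (suc k) = ℚ.toℚᵘ-injective (begin
  toℚᵘ (fromℕ (suc k) * (ℤ.+ 1 ℚ./ suc k))
    ≈⟨ ℚ.toℚᵘ-homo-* (fromℕ (suc k)) (ℤ.+ 1 ℚ./ suc k) ⟩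
  toℚᵘ (fromℕ (suc k)) ℚᵘ.* toℚᵘ (ℤ.+ 1 ℚ./ suc k)
    ≈⟨ ℚᵘ.*-cong (ℚ.toℚᵘ-fromℚᵘ (ℚᵘ.mkℚᵘ (ℤ.+ suc k) 0)) (ℚ.toℚᵘ-fromℚᵘ (ℚᵘ.mkℚᵘ (ℤ.+ 1) k)) ⟩
  ℚᵘ.mkℚᵘ (ℤ.+ suc k) 0 ℚᵘ.* ℚᵘ.mkℚᵘ (ℤ.+ 1) k
    ≈⟨ ℚᵘ.*≡* (trans (ℤ.*-identityʳ (ℤ.+ suc k ℤ.* ℤ.+ 1)) (trans (ℤ.*-identityʳ (ℤ.+ suc k))
         (trans (cong ℤ.+_ (sym (ℕ.*-identityˡ (suc k)))) (sym (ℤ.*-identityˡ (ℤ.+ (1 ℕ.* suc k))))))) ⟩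
  ℚᵘ.1ℚᵘ ∎)
  where open ℚᵘ.≃-Reasoning

card-full : ∀ {n} (G : Graph n) → card (full G) ≡ fromℕ n
card-full {n} G = go n
  where
  go : ∀ m → sum {m} (λ _ → 1ℚ) ≡ fromℕ m
  go zero    = refl
  go (suc m) = trans (cong (1ℚ +_) (go m)) (sym (fromℕ-suc m))

module _ {n : ℕ} (G : Graph n) (ω : ℕ) .{{n≢0 : ℕ.NonZero n}} .{{ω≥2 : ℕ.NonTrivial ω}} where
  open Greedy G

  -- These are the conditions on γ in `edge-Cauchy-Schwarz`. They follow from R + R ≤ d and γd = 2.
  coefficient-bound : Bounds ω (full G) →
    0ℚ ≤ coefficient n ω × coefficient n ω * ∑ᴱ G (λ e → recip (sepProb ω (full G) (src e) (tgt e))) ≤ 1ℚ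
  coefficient-bound bd = 0≤γ , *-cancelˡ 0<2 (begin
    fromℕ 2 * (γ * R)  ≡⟨ solve 2 (λ g r → con (fromℕ 2) :* (g :* r) := g :* (r :+ r)) refl γ R ⟩
    γ * (R + R)        ≤⟨ *-monoˡ 0≤γ R+R≤d ⟩
    γ * d              ≡⟨ γd≡2 ⟩
    fromℕ 2            ≡⟨⟩
    fromℕ 2 * 1ℚ       ∎)
    where
    open ℚ.≤-Reasoning
    d = denominator n ω
    γ = coefficient n ω
    R = ∑ᴱ G λ e → recip (sepProb ω (full G) (src e) (tgt e))
    instance
      d≢0 : ℚ.NonZero d
      d≢0 = denominator-nonZero n ω
      ω≢0 : ℕ.NonZero ω
      ω≢0 = ℕ.nonTrivial⇒nonZero ω
    0<2 : 0ℚ < fromℕ 2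
    0<2 = ℚ.positive⁻¹ (fromℕ 2)
    R+R≤d : R + R ≤ d
    R+R≤d = ℚ.≤-trans (recip-sep-total G ω (ℤ.+ 1 ℚ./ ω) bd (fromℕ-inverse ω)) (ℚ.≤-reflexive
      (cong ((1ℚ - (ℤ.+ 1 ℚ./ ω)) *_) (trans (cong (λ z → z * z) (card-full G)) (sym (fromℕ-* n n)))))
    0≤R : 0ℚ ≤ R
    0≤R = subst (_≤ R) (∑ᴱ-zero G) (∑ᴱ-mono G λ e →
      0≤recip (ℚ.<⇒≤ (Bounds.sep-pos bd (src e) (tgt e) refl refl (Adj⇒adj (adjacent e)))))
    -- The sign comes from 0 ≤ R + R ≤ d, and strictness from `denominator-nonZero`.
    0<d : 0ℚ < d
    0<d = ≤∧≢⇒< (ℚ.≤-trans (0≤+ 0≤R 0≤R) R+R≤d) λ 0≡d → ℚ.<-irrefl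
      (trans (sym (ℚ.*-zeroʳ (ℚ.1/ d))) (trans (cong ((ℚ.1/ d) *_) 0≡d) (ℚ.*-inverseˡ d))) 0<1
    γd≡2 : γ * d ≡ fromℕ 2
    γd≡2 = trans (ℚ.*-assoc (fromℕ 2) (ℚ.1/ d) d) (trans (cong (fromℕ 2 *_) (ℚ.*-inverseˡ d)) (ℚ.*-identityʳ (fromℕ 2)))
    0≤γ : 0ℚ ≤ γ
    0≤γ = 0≤* (ℚ.<⇒≤ 0<2) (subst (0ℚ ≤_) (recip-unique 0<d (ℚ.*-inverseʳ d)) (0≤recip (ℚ.<⇒≤ 0<d)))

-- From separation probabilities to the expected separated mass

theorem1p3 : (n : ℕ) (G : Graph n) (e₀ : Edge G) (ω : ℕ) (isω : IsCliqueNumber G ω) →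
    ∃ λ (D : Distribution (PartitionAtMost n ω)) →
    (a : Edge G → ℝ) → (∀ e → 0ℝ ≤ℝ a e) →
    fromℚ (coefficient n ω {{vertices-nonZero G e₀}} {{cliqueNumber-nonTrivial G e₀ isω}})
    *ℝ (sumEdges G (λ e → √ (a e)) *ℝ sumEdges G (λ e → √ (a e)))
    ≤ℝ expectation D (λ P → separatedMass G (proj₁ P) a)
theorem1p3 n G e₀ ω isω = distribution outcomes nonNeg total , λ a 0≤a →
  -- Cauchy-Schwarz and the formula for the expectation hold exactly at every index. Only √a · √a ≤
  -- a is an inequality of reals up to ε, and it uses a ≥ 0.
  ≤ℝ-trans (≤-seq⇒≤ℝ (Cauchy-Schwarz a)) (≤ℝ-trans (sumEdges-mono G λ e → fromℚ-*-mono (ℚ.<⇒≤ (0<p e)) (p≤1 e)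
    (proj₁ (√-square (a e) (0≤a e)))) (≤-seq⇒≤ℝ λ m → ℚ.≤-reflexive (expected a m)))
  where
  open Greedy G
  instance
    n≢0 : ℕ.NonZero n
    n≢0 = vertices-nonZero G e₀
    ω≥2 : ℕ.NonTrivial ω
    ω≥2 = cliqueNumber-nonTrivial G e₀ isω
  cb : CliqueBound ω (full G)
  cb T clique _ = IsCliqueNumber.maximal isω T clique
  bd : Bounds ω (full G)
  bd = bounds ω (full G) cb
  chains : List (ℚ × Chain G ω (full G))
  chains = greedy G ω (full G) cb
  outcomes : List (ℚ × PartitionAtMost n ω)
  -- The factor 1 brings the list into the form treated by `𝔼-map`.
  outcomes = map (λ x → 1ℚ * proj₁ x , partition G (proj₂ x)) chains
  nonNeg : All (λ x → 0ℚ ≤ proj₁ x) outcomes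
  nonNeg = All.map⁺ (All.map (0≤* 0≤1) (greedy-nonNeg G ω (full G) cb))
  total : 𝔼 outcomes (λ _ → 1ℚ) ≡ 1ℚ
  total = trans (𝔼-map 1ℚ (partition G) chains (λ _ → 1ℚ)) (trans (ℚ.*-identityˡ (𝔼 chains (λ _ → 1ℚ))) (greedy-total G ω (full G) cb))
  p : Edge G → ℚ
  p e = sepProb ω (full G) (src e) (tgt e)
  0<p : ∀ e → 0ℚ < p e
  0<p e = Bounds.sep-pos bd (src e) (tgt e) refl refl (Adj⇒adj (adjacent e))
  p≤1 : ∀ e → p e ≤ 1ℚ
  p≤1 e = Bounds.sep≤1 bd (src e) (tgt e) refl refl (Adj⇒adj (adjacent e))
  Cauchy-Schwarz : ∀ a m → seq (fromℚ (coefficient n ω) *ℝ (sumEdges G (λ e → √ (a e)) *ℝ sumEdges G (λ e → √ (a e)))) m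
    ≤ seq (sumEdges G λ e → fromℚ (p e) *ℝ (√ (a e) *ℝ √ (a e))) m
  Cauchy-Schwarz a m = subst₂ _≤_
    (cong (λ z → coefficient n ω * (z * z)) (sym (seq-sumEdges G (λ e → √ (a e)) m)))
    (sym (seq-sumEdges G (λ e → fromℚ (p e) *ℝ (√ (a e) *ℝ √ (a e))) m))
    (edge-Cauchy-Schwarz G (coefficient n ω) p (λ e → seq (√ (a e)) m)
      (proj₁ (coefficient-bound G ω bd)) 0<p (proj₂ (coefficient-bound G ω bd)))
  -- Linearity of expectation: p is the expectation of the indicator `separates`, and the edge sum
  -- is exchanged with `𝔼`.
  expected : ∀ a m → seq (sumEdges G λ e → fromℚ (p e) *ℝ a e) m ≡
    seq (expectation (distribution outcomes nonNeg total) (λ P → separatedMass G (proj₁ P) a)) m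
  expected a m = begin
    seq (sumEdges G λ e → fromℚ (p e) *ℝ a e) m
      ≡⟨ seq-sumEdges G (λ e → fromℚ (p e) *ℝ a e) m ⟩
    ∑ᴱ G (λ e → p e * seq (a e) m)
      ≡⟨ (∑ᴱ-cong G λ e → trans (𝔼-*ʳ chains (λ c → separates G c (src e) (tgt e)) (seq (a e) m))
           (cong (_* seq (a e) m) (greedy-separates G ω (full G) cb (src e) (tgt e)))) ⟨
    ∑ᴱ G (λ e → 𝔼 chains λ c → separates G c (src e) (tgt e) * seq (a e) m)
      ≡⟨ 𝔼-∑ᴱ G chains (λ c e → separates G c (src e) (tgt e) * seq (a e) m) ⟨
    𝔼 chains (λ c → ∑ᴱ G λ e → separates G c (src e) (tgt e) * seq (a e) m)
      ≡⟨ (𝔼-cong chains λ c → seq-separatedMass G c a m) ⟨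
    𝔼 chains (λ c → seq (separatedMass G (proj₁ (partition G c)) a) m)
      ≡⟨ trans (𝔼-map 1ℚ (partition G) chains (λ P → seq (separatedMass G (proj₁ P) a) m)) (ℚ.*-identityˡ _) ⟨
    𝔼 outcomes (λ P → seq (separatedMass G (proj₁ P) a) m)
      ≡⟨ seq-expectation outcomes nonNeg total (λ P → separatedMass G (proj₁ P) a) m ⟨
    seq (expectation (distribution outcomes nonNeg total) (λ P → separatedMass G (proj₁ P) a)) m ∎
    where open ≡-Reasoning
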